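{- Let $H_1,H_2$ be graphs with $2\le\chi(H_1)<\chi(H_2)$. Then $$\delta_{\mathrm{VC}}(H_1)\le\delta_{\mathrm B}(H_1)<\delta_{\mathrm{VC}}(H_2)\le\delta_{\mathrm B}(H_2).$$
   Context: All graphs are finite and simple. A graph is $H$-free if it contains no (not necessarily induced) subgraph isomorphic to $H$; it is maximal $H$-free if it is $H$-free and adding any missing edge creates a copy of $H$. $\delta(G)$ denotes minimum degree and $\chi$ the chromatic number. The VC-dimension $\mathrm{VC}(G)$ of a graph $G$ is the maximum size of a set $S\subseteq V(G)$ such that $\{N_G(v)\cap S: v\in V(G)\}=2^S$. The VC-dimension threshold $\delta_{\mathrm{VC}}(H)$ is the infimum of all $\gamma\ge 0$ for which there exists a constant $C=C(\gamma,H)$ such that every maximal $H$-free graph $G$ with $\delta(G)\ge\gamma|V(G)|$ satisfies $\mathrm{VC}(G)\le C$. A blowup of a graph $F$ is obtained by replacing each vertex of $F$ by a (possibly empty) independent set and each edge of $F$ by a complete bipartite graph between the corresponding sets. The blowup threshold $\delta_{\mathrm B}(H)$ is the infimum of all $\gamma\ge 0$ for which there exists a (finite) graph $F=F(\gamma,H)$ such that every maximal $H$-free graph $G$ with $\delta(G)\ge\gamma|V(G)|$ is a blowup of $F$. -}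

module Defs where

open import Data.Bool using (Bool; false; T; _∨_; _∧_)
open import Data.Bool.Properties as Bool using (∨-comm; ∧-comm; T?)
open import Data.Empty using (⊥-elim)
open import Data.Fin using (Fin; finToFun; funToFin)
open import Data.Fin.Properties as Fin using (any?; all?; finToFun-funToFin)
open import Data.Fin.Subset using (Subset; _⊆_; _∩_; ∣_∣)
open import Data.Fin.Subset.Properties using (anySubset?; _⊆?_)
import Data.Integer as ℤ
open import Data.List using (filter; map; upTo; allFin)
open import Data.List.Extrema.Nat using (min; max)
open import Data.Nat as ℕ using (ℕ; suc)
open import Data.Product using (∃-syntax; _×_; _,_)
open import Data.Rational using (ℚ; 0ℚ; _/_; _*_; _≤_; _<_)
open import Data.Rational.Properties using (<-trans; <-dense)
open import Data.Vec using (tabulate)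
open import Data.Vec.Properties using (≡-dec)
open import Function using (Injective)
open import Relation.Binary.PropositionalEquality using (_≡_; _≢_; refl; sym; cong₂; subst₂)
open import Relation.Nullary using (¬_; Dec; yes; no)
open import Relation.Nullary.Decidable using (⌊_⌋; map′; ¬?; _×-dec_; _→-dec_; decidable-stable)

record Graph : Set where
  field
    order  : ℕ
    adj    : Fin order → Fin order → Bool
    symm   : ∀ u v → adj u v ≡ adj v u
    irrefl : ∀ v → adj v v ≡ false

  Vertex : Set
  Vertex = Fin order

  Adj : Vertex → Vertex → Set
  Adj u v = T (adj u v)

  nbhd : Vertex → Subset order
  nbhd v = tabulate (adj v)

  degree : Vertex → ℕ
  degree v = ∣ nbhd v ∣

open Graph public

-- The default value `order G` exceeds every degree, so it only matters for
-- the graph without vertices, which gets minimum degree 0.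
minDegree : Graph → ℕ
minDegree G = min (order G) (map (degree G) (allFin (order G)))

ProperColouring : (G : Graph) {k : ℕ} → (Vertex G → Fin k) → Set
ProperColouring G f = ∀ u v → Adj G u v → f u ≢ f v

Colourable : Graph → ℕ → Set
Colourable G k = ∃[ f ] ProperColouring G {k} f

colourable? : ∀ G k → Dec (Colourable G k)
colourable? G k = map′
  (λ (i , p) → finToFun i , p)
  (λ (f , p) → funToFin f , λ u v e →
     subst₂ _≢_ (sym (finToFun-funToFin f u)) (sym (finToFun-funToFin f v)) (p u v e))
  (any? λ i → all? λ u → all? λ v →
     T? (adj G u v) →-dec ¬? (finToFun {k} {order G} i u Fin.≟ finToFun i v))

-- Every graph is `order G`-colourable, so the default value is never too big.
χ : Graph → ℕ
χ G = min (order G) (filter (colourable? G) (upTo (order G)))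

-- The inclusion { N(v) ∩ S : v ∈ V(G) } ⊆ 2^S always holds; this is the other one.
Shattered : (G : Graph) → Subset (order G) → Set
Shattered G S = ∀ A → A ⊆ S → ∃[ v ] nbhd G v ∩ S ≡ A

shattered? : ∀ G S → Dec (Shattered G S)
shattered? G S = map′
  (λ ¬∃ A → decidable-stable (P? A) λ ¬p → ¬∃ (A , ¬p))
  (λ p (A , ¬p) → ¬p (p A))
  (¬? (anySubset? λ A → ¬? (P? A)))
  where
  P? : ∀ A → Dec (A ⊆ S → ∃[ v ] nbhd G v ∩ S ≡ A)
  P? A = (A ⊆? S) →-dec any? λ v → ≡-dec Bool._≟_ (nbhd G v ∩ S) A

ShattersSize : Graph → ℕ → Set
ShattersSize G d = ∃[ S ] (Shattered G S × ∣ S ∣ ≡ d)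

shattersSize? : ∀ G d → Dec (ShattersSize G d)
shattersSize? G d = anySubset? λ S → shattered? G S ×-dec (∣ S ∣ ℕ.≟ d)

-- The empty set is shattered as soon as there is a vertex, so the default
-- value 0 only matters for the graph without vertices.
VC : Graph → ℕ
VC G = max 0 (filter (shattersSize? G) (upTo (suc (order G))))

record _IsSubgraphOf_ (H G : Graph) : Set where
  field
    embed     : Vertex H → Vertex G
    injective : Injective _≡_ _≡_ embed
    preserves : ∀ u v → Adj H u v → Adj G (embed u) (embed v)

_-free_ : Graph → Graph → Set
H -free G = ¬ (H IsSubgraphOf G)

addEdge : (G : Graph) (u v : Vertex G) → u ≢ v → Graph
addEdge G u v u≢v = record
  { order  = order G
  ; adj    = λ x y → adj G x y ∨ (x == u ∧ y == v ∨ x == v ∧ y == u)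
  ; symm   = λ x y → cong₂ _∨_ (symm G x y) (swap (x == u) (y == v) (x == v) (y == u))
  ; irrefl = λ x → cong₂ _∨_ (irrefl G x) (noLoop x)
  }
  where
  _==_ : Vertex G → Vertex G → Bool
  x == y = ⌊ x Fin.≟ y ⌋

  swap : ∀ a b c d → a ∧ b ∨ c ∧ d ≡ d ∧ c ∨ b ∧ a
  swap a b c d rewrite ∧-comm a b | ∧-comm c d = ∨-comm (b ∧ a) (d ∧ c)

  noLoop : ∀ x → x == u ∧ x == v ∨ x == v ∧ x == u ≡ false
  noLoop x with x Fin.≟ u | x Fin.≟ v
  ... | yes refl | yes refl = ⊥-elim (u≢v refl)
  ... | yes _    | no _     = refl
  ... | no _     | yes _    = refl
  ... | no _     | no _     = refl

MaximalFree : Graph → Graph → Set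
MaximalFree H G =
  H -free G ×
  (∀ u v (u≢v : u ≢ v) → ¬ Adj G u v → H IsSubgraphOf addEdge G u v u≢v)

-- The set replacing the vertex i of F is { v | part v ≡ i }; it may be empty,
-- and it is independent because F has no loops.
record _IsBlowupOf_ (G F : Graph) : Set where
  field
    part     : Vertex G → Vertex F
    adj-part : ∀ u v → adj G u v ≡ adj F (part u) (part v)

-- An extended real number, given by the set of rationals strictly above it.
record UpperReal : Set₁ where
  field
    Above  : ℚ → Set
    upward : ∀ {p q} → p < q → Above p → Above q
    open′  : ∀ {q} → Above q → ∃[ p ] (p < q × Above p)

open UpperReal public

infimum : (ℚ → Set) → UpperReal
infimum S = record
  { Above  = λ q → ∃[ γ ] (S γ × γ < q)
  ; upward = λ p<q (γ , s , γ<p) → γ , s , <-trans γ<p p<q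
  ; open′  = λ (γ , s , γ<q) → let (p , γ<p , p<q) = <-dense γ<q in p , p<q , (γ , s , γ<p)
  }

infix 4 _≤ᴿ_ _<ᴿ_

_≤ᴿ_ : UpperReal → UpperReal → Set
x ≤ᴿ y = ∀ q → Above y q → Above x q

-- `¬ Above y q` says q ≤ y.
_<ᴿ_ : UpperReal → UpperReal → Set
x <ᴿ y = ∃[ q ] (Above x q × ¬ Above y q)

fromℕ : ℕ → ℚ
fromℕ n = ℤ.+ n / 1

MinDegreeAtLeast : ℚ → Graph → Set
MinDegreeAtLeast γ G = γ * fromℕ (order G) ≤ fromℕ (minDegree G)

-- In both cases below the real γ with the stated property form an upward
-- closed set, so the rational ones among them have the same infimum.

BoundsVC : Graph → ℚ → Set
BoundsVC H γ =
  0ℚ ≤ γ ×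
  ∃[ C ] (∀ G → MaximalFree H G → MinDegreeAtLeast γ G → VC G ℕ.≤ C)

BoundsBlowup : Graph → ℚ → Set
BoundsBlowup H γ =
  0ℚ ≤ γ ×
  ∃[ F ] (∀ G → MaximalFree H G → MinDegreeAtLeast γ G → G IsBlowupOf F)

δ-VC : Graph → UpperReal
δ-VC H = infimum (BoundsVC H)

δ-B : Graph → UpperReal
δ-B H = infimum (BoundsBlowup H)

{-# OPTIONS --safe #-}
-- Let r = χ(H₁) = m + 2. If δ(G) ≥ γ n with γ > m / (m + 1), the Erdős–Stone theorem bounds the
-- order of an H₁-free graph G, so δ-B(H₁) ≤ m / (m + 1).
--
-- For H = H₂, which is not (m + 2)-colourable, choose an induced subgraph H[S] that is minimal in
-- the homomorphism order among those with H → H[S] ∨ K_m; it is a core and not bipartite, so it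
-- has an edge xy that is not a bridge. Take vertices x_i, y_j (over x, y) joined according to a
-- pattern that shatters {x_i}, and for every non-edge (i , j) of the pattern a private copy of
-- H[S] − xy attached to x_i and y_j. Every vertex over c is also joined to a large complete
-- bipartite graph of its own index c, which gives linear degrees, and everything is joined to a
-- complete m-partite graph. A homomorphism from H to this graph would yield a section of the
-- projection to H[S], and the section would make xy a bridge. In the blowup of this graph, the
-- edges that a maximal H-free supergraph adds between the copies of x_i and y_j, (i , j) a
-- non-edge, span no large biclique; by Ramsey's theorem for bipartite graphs there are copies of
-- all x_i and y_j without any added edges, and they show that the VC-dimension is unbounded.
-- The sizes are such that the minimum degree exceeds (m / (m + 1)) n by a constant proportion.
module Submission where

open import Defs
open import Data.Bool using (Bool; true; false; T; not; if_then_else_; _∧_; _∨_; _xor_)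
open import Data.Bool.Properties as Bool using (T?; T-∨; ∧-comm; ∧-idem)
open import Data.Empty using (⊥; ⊥-elim)
open import Data.Fin as Fin using (Fin; zero; suc; toℕ; fromℕ<; finToFun; funToFin; inject≤; punchIn; combine; remQuot; splitAt; _↑ˡ_)
open import Data.Fin.Induction using (spo-wellFounded)
open import Data.Fin.Properties as Fin using (any?; pigeonhole; finToFun-funToFin; injective⇒≤; suc-injective; inject≤-injective; remQuot-combine; +↔⊎; *↔×)
open import Data.Fin.Subset using (Subset; ∣_∣; _∈_; _⊆_; _∩_; ⁅_⁆)
open import Data.Fin.Subset.Properties using (⊆-antisym; x∈p∩q⁺; x∈p∩q⁻; _∈?_; x∈⁅y⁆⇒x≡y; x∈⁅x⁆; ∣p∣≤n)
import Data.Integer as ℤ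
import Data.Integer.Properties as ℤ
open import Data.List using (List; []; _∷_; length; upTo; map; allFin; filter; cartesianProduct)
open import Data.List.Extrema.Nat using (min≤xs; min≤⊤; argmin-sel; v≤min⁺; max≤v⁺; xs≤max)
open import Data.List.Membership.Propositional using () renaming (_∈_ to _∈ˡ_)
open import Data.List.Membership.Propositional.Properties using (∈-filter⁺; ∈-filter⁻; ∈-upTo⁺; ∈-map⁺; ∈-allFin; ∈-cartesianProduct⁺)
open import Data.List.Relation.Unary.All as All using (All; []; _∷_)
open import Data.List.Relation.Unary.All.Properties using (map⁺)
open import Data.List.Relation.Unary.Any using (here; there)
open import Data.Nat as ℕ using (ℕ; zero; suc; _+_; _*_; _^_; _≤_; _<_; z≤n; s≤s)
open import Data.Nat.Properties as ℕ hiding (suc-injective; _≟_)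
open import Data.Nat.Solver using (module +-*-Solver)
open import Data.Product using (∃; ∃-syntax; ∃₂; _×_; _,_; proj₁; proj₂)
open import Data.Product.Function.NonDependent.Propositional using (_×-↔_)
import Data.Rational as ℚ
import Data.Rational.Properties as ℚ
open import Data.Rational.Unnormalised as ℚᵘ using (mkℚᵘ)
import Data.Rational.Unnormalised.Properties as ℚᵘ
open import Data.Sum as Sum using (_⊎_; inj₁; inj₂; [_,_]′)
open import Data.Sum.Function.Propositional using (_⊎-↔_)
open import Data.Unit using (⊤; tt)
open import Data.Vec using (tabulate; lookup)
open import Data.Vec.Functional using (removeAt)
open import Data.Vec.Properties using (lookup∘tabulate; lookup⇒[]=; []=⇒lookup; tabulate∘lookup)
open import Function using (_∘_; id; Injective; _↔_; Inverse; Equivalence)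
open import Function.Construct.Composition using (_↔-∘_)
open import Function.Construct.Identity using (↔-id)
open import Induction.WellFounded using (WellFounded; Acc; acc)
open import Relation.Binary.PropositionalEquality using (_≡_; _≢_; refl; sym; trans; cong; cong₂; subst; subst₂; isEquivalence; module ≡-Reasoning)
open import Relation.Nullary using (¬_; Dec; yes; no; contradiction)
open import Relation.Nullary.Decidable using (⌊_⌋; toWitness; fromWitness; map′; ¬?; _×-dec_; _⊎-dec_)
open import Algebra.Properties.CommutativeMonoid.Sum ℕ.+-0-commutativeMonoid using (sum; sum-remove; sum-cong-≗; ∑-comm; ∑-distrib-+)

-- Counting and the pigeonhole principle

Inj : {A B : Set} → (A → B) → Set
Inj = Injective _≡_ _≡_

indicator : Bool → ℕ
indicator true  = 1
indicator false = 0

indicator≤1 : ∀ b → indicator b ≤ 1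
indicator≤1 true  = ≤-refl
indicator≤1 false = z≤n

count : ∀ {n} → (Fin n → Bool) → ℕ
count p = sum (indicator ∘ p)

sum-mono-≤ : ∀ {n} {f g : Fin n → ℕ} → (∀ i → f i ≤ g i) → sum f ≤ sum g
sum-mono-≤ {zero}  le = z≤n
sum-mono-≤ {suc n} le = +-mono-≤ (le zero) (sum-mono-≤ (le ∘ suc))

sum-const : ∀ n k → sum {n} (λ _ → k) ≡ n * k
sum-const zero    k = refl
sum-const (suc n) k = cong (k +_) (sum-const n k)

sum-*ˡ : ∀ {n} k (f : Fin n → ℕ) → sum (λ i → k * f i) ≡ k * sum f
sum-*ˡ {zero}  k f = sym (*-zeroʳ k)
sum-*ˡ {suc n} k f = trans (cong (k * f zero +_) (sum-*ˡ k (f ∘ suc)))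
                           (sym (*-distribˡ-+ k (f zero) (sum (f ∘ suc))))

sum≤max*n : ∀ {n} {k} (f : Fin n → ℕ) → (∀ i → f i ≤ k) → sum f ≤ n * k
sum≤max*n {n} {k} f le = ≤-trans (sum-mono-≤ le) (≤-reflexive (sum-const n k))

-- The other `j` terms contribute at most `j * s`.
summand-large : ∀ {j s t} (f : Fin (suc j) → ℕ) → (∀ i → f i ≤ s) →
                j * s + t ≤ sum f → ∀ i → t ≤ f i
summand-large {j} {s} {t} f f≤s large i = +-cancelˡ-≤ (j * s) t (f i) (begin
  j * s + t                   ≤⟨ large ⟩
  sum f                       ≡⟨ sum-remove {i = i} f ⟩
  f i + sum (removeAt f i)    ≤⟨ +-monoʳ-≤ (f i) (sum≤max*n (removeAt f i) (λ k → f≤s (punchIn i k))) ⟩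
  f i + j * s                 ≡⟨ +-comm (f i) (j * s) ⟩
  j * s + f i                 ∎)
  where open ≤-Reasoning

count≤n : ∀ {n} (p : Fin n → Bool) → count p ≤ n
count≤n {n} p = ≤-trans (sum≤max*n (indicator ∘ p) (indicator≤1 ∘ p)) (≤-reflexive (*-identityʳ n))

cardinality-tabulate : ∀ {n} (p : Fin n → Bool) → ∣ tabulate p ∣ ≡ count p
cardinality-tabulate {zero}  p = refl
cardinality-tabulate {suc n} p with p zero
... | true  = cong suc (cardinality-tabulate (p ∘ suc))
... | false = cardinality-tabulate (p ∘ suc)

extendInj : ∀ {n k} {e : Fin k → Fin n} → Inj e → ∃[ e′ ] (Inj {Fin (suc k)} {Fin (suc n)} e′)
extendInj {n} {k} {e} inj = e′ , inj′
  where
  e′ : Fin (suc k) → Fin (suc n)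
  e′ zero    = zero
  e′ (suc i) = suc (e i)
  inj′ : Inj e′
  inj′ {zero}  {zero}  _  = refl
  inj′ {suc i} {suc j} eq = cong suc (inj (suc-injective eq))

count-enumerate : ∀ {n} (p : Fin n → Bool) →
                  ∃[ e ] (Inj {Fin (count p)} {Fin n} e × ∀ i → T (p (e i)))
count-enumerate {zero}  p = (λ ()) , (λ { {()} }) , λ ()
count-enumerate {suc n} p with p zero in eq | count-enumerate (p ∘ suc)
... | false | e , inj , mem = suc ∘ e , inj ∘ suc-injective , mem
... | true  | e , inj , mem = e′ , proj₂ (extendInj inj) , mem′
  where
  e′ : Fin (suc (count (p ∘ suc))) → Fin (suc n)
  e′ = proj₁ (extendInj inj)
  mem′ : ∀ i → T (p (e′ i))
  mem′ zero    rewrite eq = tt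
  mem′ (suc i) = mem i

enumerate : ∀ {n k} (p : Fin n → Bool) → k ≤ count p →
            ∃[ e ] (Inj {Fin k} {Fin n} e × ∀ i → T (p (e i)))
enumerate p k≤ with count-enumerate p
... | e , inj , mem = (λ i → e (inject≤ i k≤)) , inject≤-injective k≤ k≤ _ _ ∘ inj , λ i → mem (inject≤ i k≤)

-- Induction on `n`, removing `zero` together with its preimage under `e`, if there is one.
injection⇒≤count : ∀ {n k} (p : Fin n → Bool) (e : Fin k → Fin n) → Inj e → (∀ i → T (p (e i))) → k ≤ count p
injection⇒≤count {zero}  {zero}  p e inj mem = z≤n
injection⇒≤count {zero}  {suc k} p e inj mem with () ← e zero
injection⇒≤count {suc n} {k} p e inj mem with any? (λ i → e i Fin.≟ zero)
injection⇒≤count {suc n} {k} p e inj mem | no none =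
  ≤-trans (injection⇒≤count (p ∘ suc) e′ inj′ mem′) (m≤n+m _ (indicator (p zero)))
  where
  nz : ∀ i → zero ≢ e i
  nz i eq = none (i , sym eq)
  e′ : Fin k → Fin n
  e′ i = Fin.punchOut (nz i)
  inj′ : Inj e′
  inj′ {i} {j} eq = inj (Fin.punchOut-injective (nz i) (nz j) eq)
  mem′ : ∀ i → T (p (suc (e′ i)))
  mem′ i = subst (T ∘ p) (sym (Fin.punchIn-punchOut (nz i))) (mem i)
injection⇒≤count {suc n} {suc k} p e inj mem | yes (a , ea) =
  +-mono-≤ p0 (injection⇒≤count (p ∘ suc) e′ inj′ mem′)
  where
  p0 : 1 ≤ indicator (p zero)
  p0 with p zero | subst (T ∘ p) ea (mem a)
  ... | true | _ = ≤-refl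
  nz : ∀ i → zero ≢ e (punchIn a i)
  nz i eq = Fin.punchInᵢ≢i a i (inj (trans (sym eq) (sym ea)))
  e′ : Fin k → Fin n
  e′ i = Fin.punchOut (nz i)
  inj′ : Inj e′
  inj′ {i} {j} eq = Fin.punchIn-injective a i j (inj (Fin.punchOut-injective (nz i) (nz j) eq))
  mem′ : ∀ i → T (p (suc (e′ i)))
  mem′ i = subst (T ∘ p) (sym (Fin.punchIn-punchOut (nz i))) (mem (punchIn a i))

count-singleton : ∀ {c} (v : Fin c) → count (λ w → ⌊ v Fin.≟ w ⌋) ≡ 1
count-singleton {c} v = ≤-antisym upper
  (injection⇒≤count {k = 1} (λ w → ⌊ v Fin.≟ w ⌋) (λ _ → v) (λ { {zero} {zero} _ → refl }) (λ _ → fromWitness refl))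
  where
  upper : count (λ w → ⌊ v Fin.≟ w ⌋) ≤ 1
  upper with count-enumerate (λ w → ⌊ v Fin.≟ w ⌋)
  ... | e , inj , mem = injective⇒≤ {n = 1} {f = λ _ → zero} (λ {i} {j} _ → inj (trans (sym (at i)) (at j)))
    where
    at : ∀ i → v ≡ e i
    at i = toWitness (mem i)

sum>⇒term> : ∀ {n k} (f : Fin n → ℕ) → n * k < sum f → ∃[ i ] k < f i
sum>⇒term> {n} {k} f large with any? (λ i → k ℕ.<? f i)
... | yes found = found
... | no  none  = contradiction (sum≤max*n f (λ i → ≮⇒≥ (λ lt → none (i , lt)))) (<⇒≱ large)

-- The fibres of `f` partition the elements counted by `p`; `c` fibres with at most `k` of them each
-- would give at most `c * k`.
pigeonhole-count : ∀ {n c k} (p : Fin n → Bool) (f : Fin n → Fin c) → c * k < count p →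
                   ∃[ v ] k < count (λ i → p i ∧ ⌊ f i Fin.≟ v ⌋)
pigeonhole-count {n} {c} {k} p f large = sum>⇒term> _ (subst (c * k <_) (sym fibres) large)
  where
  split : ∀ i → sum {c} (λ v → indicator (p i ∧ ⌊ f i Fin.≟ v ⌋)) ≡ indicator (p i)
  split i with p i
  ... | true  = count-singleton (f i)
  ... | false = trans (sum-const c 0) (*-zeroʳ c)
  fibres : sum {c} (λ v → count (λ i → p i ∧ ⌊ f i Fin.≟ v ⌋)) ≡ count p
  fibres = trans (∑-comm (λ v i → indicator (p i ∧ ⌊ f i Fin.≟ v ⌋))) (sum-cong-≗ split)

T-∧ˡ : ∀ {a b} → T (a ∧ b) → T a
T-∧ˡ {true} _ = tt

T-∧ʳ : ∀ {a b} → T (a ∧ b) → T b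
T-∧ʳ {true} t = t

T-not : ∀ {b} → T (not b) → ¬ T b
T-not {false} _ ()

T-not⁺ : ∀ {b} → ¬ T b → T (not b)
T-not⁺ {false} _ = tt
T-not⁺ {true} ¬b = ¬b tt

T-∧⁺ : ∀ {a b} → T a → T b → T (a ∧ b)
T-∧⁺ {true} _ t = t

bit : Bool → Fin 2
bit false = zero
bit true  = suc zero

bit-injective : ∀ {a b} → bit a ≡ bit b → a ≡ b
bit-injective {false} {false} _ = refl
bit-injective {true}  {true}  _ = refl

-- Numbered subsets serve as values for the pigeonhole principle, as rows of adjacency matrices, as
-- indices of the vertices y_j and as elements of a finite order.
code : ∀ {n} → (Fin n → Bool) → Fin (2 ^ n)
code s = funToFin (bit ∘ s)

code-injective : ∀ {n} {s s′ : Fin n → Bool} → code s ≡ code s′ → ∀ i → s i ≡ s′ i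
code-injective {s = s} {s′} eq i = bit-injective
  (trans (sym (finToFun-funToFin (bit ∘ s) i))
  (trans (cong (λ c → finToFun c i) eq) (finToFun-funToFin (bit ∘ s′) i)))

decode : ∀ {n} → Fin (2 ^ n) → Fin n → Bool
decode c i = ⌊ finToFun c i Fin.≟ suc zero ⌋

decode-code : ∀ {n} (s : Fin n → Bool) i → decode (code s) i ≡ s i
decode-code s i rewrite finToFun-funToFin (bit ∘ s) i with s i
... | true  = refl
... | false = refl

-- Pigeonhole on the `2 ^ K` possible traces `R i`; `e zero` serves as the representative.
same-trace : ∀ {n K k} (p : Fin n → Bool) (R : Fin n → Fin K → Bool) → 2 ^ K * k < count p →
             ∃[ e ] (Inj {Fin (suc k)} {Fin n} e × (∀ i → T (p (e i))) × ∀ i a → R (e i) a ≡ R (e zero) a)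
same-trace {n} {K} {k} p R large with pigeonhole-count p (code ∘ R) large
... | c , k<q with enumerate (λ i → p i ∧ ⌊ code (R i) Fin.≟ c ⌋) k<q
... | e , inj , mem = e , inj , (λ i → T-∧ˡ (mem i)) , λ i → code-injective (trans (codeOf i) (sym (codeOf zero)))
  where
  codeOf : ∀ i → code (R (e i)) ≡ c
  codeOf i = toWitness (T-∧ʳ {p (e i)} (mem i))

count-all : ∀ n → count {n} (λ _ → true) ≡ n
count-all n = trans (sum-const n 1) (*-identityʳ n)

count-not : ∀ {n} (p : Fin n → Bool) → count p + count (not ∘ p) ≡ n
count-not {n} p = trans (sym (∑-distrib-+ (indicator ∘ p) (indicator ∘ not ∘ p)))
                        (trans (sum-cong-≗ one) (count-all n))
  where
  one : ∀ i → indicator (p i) + indicator (not (p i)) ≡ 1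
  one i with p i
  ... | true  = refl
  ... | false = refl

m+n≡o+o⇒o≤m⊎o≤n : ∀ {m n o} → m + n ≡ o + o → o ≤ m ⊎ o ≤ n
m+n≡o+o⇒o≤m⊎o≤n {m} {n} {o} eq with o ℕ.≤? m | o ℕ.≤? n
... | yes le | _      = inj₁ le
... | no _   | yes le = inj₂ le
... | no gt₁ | no gt₂ = contradiction eq (<⇒≢ (+-mono-< (≰⇒> gt₁) (≰⇒> gt₂)))

-- Ramsey's theorem for bipartite graphs

Avoids : ∀ {t k} → (Fin t → Fin t → Bool) → (Fin k → Fin t) → (Fin k → Fin t) → Set
Avoids R α β = ∀ a b → ¬ T (R (α a) (β b))

Fills : ∀ {t k} → (Fin t → Fin t → Bool) → (Fin k → Fin t) → (Fin k → Fin t) → Set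
Fills R α β = ∀ a b → T (R (α a) (β b))

BicliqueFree : ∀ {t} → ℕ → (Fin t → Fin t → Bool) → Set
BicliqueFree {t} N R = (α β : Fin N → Fin t) → Inj α → Inj β → ¬ Fills R α β

-- With `L = N + K`, the first summand supplies `L + L` rows; the second exceeds `2 ^ (L + L) * L`,
-- which forces more than `L` columns to have the same trace on these rows.
ramseySize : ℕ → ℕ → ℕ
ramseySize N K = (N + K + (N + K)) + suc (2 ^ (N + K + (N + K)) * (N + K))

-- Among `L + L` rows on which `suc L` columns agree, at least `L` are joined to all of these
-- columns or at least `L` to none. The first case contains a biclique of size `N`, the second the
-- sets sought.
bipartiteRamsey : ∀ N K (R : Fin (ramseySize N K) → Fin (ramseySize N K) → Bool) → BicliqueFree N R →
                  ∃₂ λ α β → Inj {Fin K} α × Inj {Fin K} β × Avoids R α β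
bipartiteRamsey N K R free = go (same-trace (λ _ → true) (λ y x → R (row x) y) large)
  where
  L t : ℕ
  L = N + K
  t = ramseySize N K
  row : Fin (L + L) → Fin t
  row x = x Fin.↑ˡ suc (2 ^ (L + L) * L)
  row-inj : Inj row
  row-inj = Fin.↑ˡ-injective _ _ _
  large : 2 ^ (L + L) * L < count {t} (λ _ → true)
  large = ≤-trans (m≤n+m _ (L + L)) (≤-reflexive (sym (count-all t)))
  K≤L : K ≤ suc L
  K≤L = m≤n⇒m≤1+n (m≤n+m K N)
  N≤L : N ≤ suc L
  N≤L = m≤n⇒m≤1+n (m≤m+n N K)
  go : ∃[ e ] (Inj {Fin (suc L)} {Fin t} e × (∀ i → T true) × ∀ i a → R (row a) (e i) ≡ R (row a) (e zero)) →
       ∃₂ λ α β → Inj {Fin K} α × Inj {Fin K} β × Avoids R α β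
  go (e , inj , _ , same) with m+n≡o+o⇒o≤m⊎o≤n (count-not (λ a → R (row a) (e zero)))
  ... | inj₁ L≤ = let (f , f-inj , mem) = enumerate (λ a → R (row a) (e zero)) (≤-trans (m≤m+n N K) L≤) in
        ⊥-elim (free (row ∘ f) (λ b → e (inject≤ b N≤L)) (f-inj ∘ row-inj) (inject≤-injective N≤L N≤L _ _ ∘ inj)
          (λ a b → subst T (sym (same (inject≤ b N≤L) (f a))) (mem a)))
  ... | inj₂ L≤ = let (f , f-inj , mem) = enumerate (λ a → not (R (row a) (e zero))) (≤-trans (m≤n+m K N) L≤) in
        row ∘ f , (λ b → e (inject≤ b K≤L)) , f-inj ∘ row-inj , inject≤-injective K≤L K≤L _ _ ∘ inj ,
          λ a b r → T-not {R (row (f a)) (e zero)} (mem a) (subst T (same (inject≤ b K≤L) (f a)) r)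

iteratedRamseySize : ℕ → ℕ → ℕ → ℕ
iteratedRamseySize N zero    K = K
iteratedRamseySize N (suc l) K = iteratedRamseySize N l (ramseySize N K)

-- Biclique-freeness and avoidance pass to subsets, so the relations can be treated one after
-- another, the head of the list last.
iteratedRamsey : ∀ {I : Set} N (is : List I) K
                 (R : I → Fin (iteratedRamseySize N (length is) K) → Fin (iteratedRamseySize N (length is) K) → Bool) →
                 All (λ i → BicliqueFree N (R i)) is →
                 ∃₂ λ α β → Inj {Fin K} α × Inj {Fin K} β × All (λ i → Avoids (R i) α β) is
iteratedRamsey N []       K R []           = id , id , id , id , []
iteratedRamsey N (i ∷ is) K R (free ∷ frees)
  with iteratedRamsey N is (ramseySize N K) R frees
... | α , β , α-inj , β-inj , avoid
  with bipartiteRamsey N K (λ a b → R i (α a) (β b))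
         (λ γ δ γ-inj δ-inj → free (α ∘ γ) (β ∘ δ) (γ-inj ∘ α-inj) (δ-inj ∘ β-inj))
... | γ , δ , γ-inj , δ-inj , avoid-i =
  α ∘ γ , β ∘ δ , γ-inj ∘ α-inj , δ-inj ∘ β-inj , avoid-i ∷ All.map (λ av a b → av (γ a) (δ b)) avoid

-- Degrees, colourings and adjacency

T⇒≡ : ∀ {b} → T b → b ≡ true
T⇒≡ {true} _ = refl

degree≡count : ∀ G v → degree G v ≡ count (adj G v)
degree≡count G v = cardinality-tabulate (adj G v)

minDegree≤degree : ∀ G v → minDegree G ≤ degree G v
minDegree≤degree G v = All.lookup (min≤xs (order G) (map (degree G) (allFin (order G)))) (∈-map⁺ (degree G) (∈-allFin v))

≤minDegree : ∀ G {k} → k ≤ order G → (∀ v → k ≤ degree G v) → k ≤ minDegree G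
≤minDegree G k≤n k≤deg = v≤min⁺ {xs = map (degree G) (allFin (order G))} k≤n (map⁺ {xs = allFin (order G)} (All.tabulate (λ {v} _ → k≤deg v)))

χ-colourable : ∀ G → Colourable G (χ G)
χ-colourable G with argmin-sel id (order G) (filter (colourable? G) (upTo (order G)))
-- The default value `order G` of the minimum: every vertex gets its own colour.
... | inj₁ eq = subst (Colourable G) (sym eq) (id , λ u v e u≡v → subst T (trans (cong (adj G u) (sym u≡v)) (irrefl G u)) e)
... | inj₂ χ∈ = proj₂ (∈-filter⁻ (colourable? G) {xs = upTo (order G)} χ∈)

<χ⇒¬colourable : ∀ G {k} → k < χ G → ¬ Colourable G k
<χ⇒¬colourable G {k} k<χ col = <⇒≱ k<χ (All.lookup (min≤xs (order G) (filter (colourable? G) (upTo (order G))))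
  (∈-filter⁺ (colourable? G) (∈-upTo⁺ (≤-trans k<χ (min≤⊤ (order G) (filter (colourable? G) (upTo (order G)))))) col))

Adj-irrefl : ∀ G {u v} → Adj G u v → u ≢ v
Adj-irrefl G {u} e refl = subst T (irrefl G u) e

Adj-sym : ∀ G {u v} → Adj G u v → Adj G v u
Adj-sym G {u} {v} = subst T (symm G u v)

-- The minimum degree version of the Erdős–Stone theorem

-- Injectivity within each part makes the whole family injective, as vertices of different parts are
-- adjacent.
record Multipartite (G : Graph) (j s : ℕ) : Set where
  field
    vertex    : Fin j → Fin s → Vertex G
    injective : ∀ a → Inj (vertex a)
    complete  : ∀ {a b} → a ≢ b → ∀ i k → Adj G (vertex a i) (vertex b k)

-- With parts of size `order H`, each vertex `u` has position `u` reserved in every part, and its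
-- colour selects the part.
colourable⇒⊆multipartite : ∀ H G {r} → Colourable H r → Multipartite G r (order H) → H IsSubgraphOf G
colourable⇒⊆multipartite H G (f , proper) K = record
  { embed     = λ u → vertex (f u) u
  ; injective = λ {u} {v} eq → inj u v eq
  ; preserves = λ u v e → complete (proper u v e) u v
  }
  where
  open Multipartite K
  inj : ∀ u v → vertex (f u) u ≡ vertex (f v) v → u ≡ v
  inj u v eq with f u Fin.≟ f v
  ... | yes fu≡fv = injective (f v) (trans (cong (λ a → vertex a u) (sym fu≡fv)) eq)
  ... | no  fu≢fv = contradiction eq (Adj-irrefl G (complete fu≢fv u v))

private
  expand : ∀ D n j t → D * (n * (j * (D * suc t) + t)) + D * n ≡ D * suc t * n * (j * D + 1)
  expand = solve 4 (λ D n j t → D :* (n :* (j :* (D :* (con 1 :+ t)) :+ t)) :+ D :* n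
                                := D :* (con 1 :+ t) :* n :* (j :* D :+ con 1)) refl
    where open +-*-Solver

  rearrange : ∀ s n J A → s * n * (J * A) ≡ J * (s * (A * n))
  rearrange = solve 4 (λ s n J A → s :* n :* (J :* A) := J :* (s :* (A :* n))) refl
    where open +-*-Solver

-- Averaging over the vertices of the parts, at least n / ((j + 1) s) vertices
-- of G see at least t vertices in every part.
module _ (G : Graph) {A D j t : ℕ} .{{_ : ℕ.NonZero D}} (K : Multipartite G (suc j) (D * suc t))
         (dense : j * D + 1 ≤ suc j * A) (deg : ∀ v → A * order G ≤ D * degree G v) where

  open Multipartite K

  private
    n J s : ℕ
    n = order G
    J = suc j
    s = D * suc t

    hits : Vertex G → Fin J → ℕ
    hits v a = count (λ i → adj G v (vertex a i))

    hits≤ : ∀ v a → hits v a ≤ s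
    hits≤ v a = count≤n (λ i → adj G v (vertex a i))

    seen : Vertex G → ℕ
    seen v = sum (hits v)

    good : Vertex G → Bool
    good v = ⌊ (j * s + t) ℕ.≤? seen v ⌋

    seen≤ : ∀ v → seen v ≤ J * s * indicator (good v) + (j * s + t)
    seen≤ v with (j * s + t) ℕ.≤? seen v
    ... | yes _ = ≤-trans (sum≤max*n (hits v) (hits≤ v))
                    (≤-trans (≤-reflexive (sym (*-identityʳ (J * s)))) (m≤m+n _ (j * s + t)))
    ... | no lt = ≤-trans (<⇒≤ (≰⇒> lt)) (m≤n+m _ (J * s * 0))

    swap : sum seen ≡ sum (λ a → sum (λ i → degree G (vertex a i)))
    swap = trans (∑-comm hits)
      (sum-cong-≗ λ a → trans (∑-comm (λ v i → indicator (adj G v (vertex a i))))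
        (sum-cong-≗ λ i → trans (sum-cong-≗ λ v → cong indicator (symm G v (vertex a i)))
          (sym (degree≡count G (vertex a i)))))

    lower : J * (s * (A * n)) ≤ D * sum seen
    lower = begin
      J * (s * (A * n))                                      ≡⟨ cong (J *_) (sum-const s (A * n)) ⟨
      J * sum {s} (λ _ → A * n)                              ≡⟨ sum-const J (sum {s} (λ _ → A * n)) ⟨
      sum {J} (λ _ → sum {s} (λ _ → A * n))                  ≤⟨ sum-mono-≤ (λ a → sum-mono-≤ (λ i → deg (vertex a i))) ⟩
      sum (λ a → sum (λ i → D * degree G (vertex a i)))      ≡⟨ sum-cong-≗ (λ a → sum-*ˡ D (λ i → degree G (vertex a i))) ⟩
      sum (λ a → D * sum (λ i → degree G (vertex a i)))      ≡⟨ sum-*ˡ D (λ a → sum (λ i → degree G (vertex a i))) ⟩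
      D * sum (λ a → sum (λ i → degree G (vertex a i)))      ≡⟨ cong (D *_) swap ⟨
      D * sum seen                                           ∎
      where open ≤-Reasoning

    upper : sum seen ≤ J * s * count good + n * (j * s + t)
    upper = begin
      sum seen                                                           ≤⟨ sum-mono-≤ seen≤ ⟩
      sum (λ v → J * s * indicator (good v) + (j * s + t))               ≡⟨ ∑-distrib-+ (λ v → J * s * indicator (good v)) (λ _ → j * s + t) ⟩
      sum (λ v → J * s * indicator (good v)) + sum {n} (λ _ → j * s + t) ≡⟨ cong₂ _+_ (sum-*ˡ (J * s) (indicator ∘ good)) (sum-const n (j * s + t)) ⟩
      J * s * count good + n * (j * s + t)                               ∎
      where open ≤-Reasoning

    -- The surplus `1` in `dense`, scaled by `s = D * suc t`, is worth `suc t` hits per vertex of G.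
    -- The threshold `j * s + t` absorbs `t` of them; the remaining `n` hits are due to good
    -- vertices, each of which accounts for at most `J * s`.
    manyGood : n ≤ J * s * count good
    manyGood = *-cancelˡ-≤ D (+-cancelˡ-≤ (D * (n * (j * s + t))) (D * n) (D * (J * s * count good)) (begin
      D * (n * (j * s + t)) + D * n                     ≡⟨ expand D n j t ⟩
      s * n * (j * D + 1)                               ≤⟨ *-monoʳ-≤ (s * n) dense ⟩
      s * n * (J * A)                                   ≡⟨ rearrange s n J A ⟩
      J * (s * (A * n))                                 ≤⟨ lower ⟩
      D * sum seen                                      ≤⟨ *-monoʳ-≤ D upper ⟩
      D * (J * s * count good + n * (j * s + t))        ≡⟨ *-distribˡ-+ D (J * s * count good) (n * (j * s + t)) ⟩
      D * (J * s * count good) + D * (n * (j * s + t))  ≡⟨ +-comm (D * (J * s * count good)) (D * (n * (j * s + t))) ⟩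
      D * (n * (j * s + t)) + D * (J * s * count good)  ∎))
      where open ≤-Reasoning

    good-sees : ∀ v → T (good v) → ∀ a → t ≤ hits v a
    good-sees v g = summand-large (hits v) (hits≤ v) (toWitness g)

    trace : Vertex G → Fin (J * s) → Bool
    trace v k = let (a , i) = remQuot {J} s k in adj G v (vertex a i)

    -- The vertices `e k` have the same neighbours in the old parts, at least `t` in each. These
    -- neighbours form the shrunken parts, and the `e k` form the new one.
    fromTrace : ∃[ e ] (Inj {Fin (suc t)} {Vertex G} e × (∀ i → T (good (e i))) × ∀ i a → trace (e i) a ≡ trace (e zero) a) →
                Multipartite G (suc J) t
    fromTrace (e , e-inj , e-good , same) = record { vertex = vertex′ ; injective = inj′ ; complete = compl }
      where
      v₀ : Vertex G
      v₀ = e zero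
      same′ : ∀ k a i → adj G (e k) (vertex a i) ≡ adj G v₀ (vertex a i)
      same′ k a i = subst (λ (b , l) → adj G (e k) (vertex b l) ≡ adj G v₀ (vertex b l)) (remQuot-combine a i) (same k (combine a i))
      pick : ∀ a → ∃[ f ] (Inj {Fin t} {Fin s} f × ∀ i → T (adj G v₀ (vertex a (f i))))
      pick a = enumerate (λ i → adj G v₀ (vertex a i)) (good-sees v₀ (e-good zero) a)
      old : Fin J → Fin t → Vertex G
      old a i = vertex a (proj₁ (pick a) i)
      joined : ∀ k a i → Adj G (e k) (old a i)
      joined k a i = subst T (sym (same′ k a (proj₁ (pick a) i))) (proj₂ (proj₂ (pick a)) i)
      t≤1+t : t ≤ suc t
      t≤1+t = n≤1+n t
      vertex′ : Fin (suc J) → Fin t → Vertex G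
      vertex′ zero    i = e (inject≤ i t≤1+t)
      vertex′ (suc a) i = old a i
      inj′ : ∀ a → Inj (vertex′ a)
      inj′ zero    = inject≤-injective t≤1+t t≤1+t _ _ ∘ e-inj
      inj′ (suc a) = proj₁ (proj₂ (pick a)) ∘ injective a
      compl : ∀ {a b} → a ≢ b → ∀ i k → Adj G (vertex′ a i) (vertex′ b k)
      compl {zero}  {zero}  ne i k = ⊥-elim (ne refl)
      compl {zero}  {suc b} ne i k = joined (inject≤ i t≤1+t) b k
      compl {suc a} {zero}  ne i k = Adj-sym G (joined (inject≤ k t≤1+t) a i)
      compl {suc a} {suc b} ne i k = complete (ne ∘ cong suc) (proj₁ (pick a) i) (proj₁ (pick b) k)

  addPart : J * s * (2 ^ (J * s) * t) < n → Multipartite G (suc J) t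
  addPart large = fromTrace (same-trace good trace
    (*-cancelˡ-< (J * s) (2 ^ (J * s) * t) (count good) (<-≤-trans large manyGood)))

-- A sum in place of a maximum: the first summand provides the previous parts with the larger size
-- `s`, the second is the bound that `addPart` asks for.
multipartiteBound : ℕ → ℕ → ℕ → ℕ
multipartiteBound D zero    t = t
multipartiteBound D (suc j) t =
  let s = D * suc t in multipartiteBound D j s + suc (suc j * s * (2 ^ (suc j * s) * t))

-- Mutual induction on the number of parts: `erdősStone` adds a part to the output of
-- `multipartite`, which in turn lowers the density required.
erdősStone : ∀ G {A D} .{{_ : ℕ.NonZero D}} j t → j * D + 1 ≤ suc j * A →
             (∀ v → A * order G ≤ D * degree G v) → multipartiteBound D (suc j) t ≤ order G → Multipartite G (suc (suc j)) t
multipartite : ∀ G {A D} .{{_ : ℕ.NonZero D}} j t → j * D + 1 ≤ suc j * A →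
               (∀ v → A * order G ≤ D * degree G v) → multipartiteBound D j t ≤ order G → Multipartite G (suc j) t

erdősStone G {A} {D} j t dense deg bound =
  addPart G {A} {D} {j} {t} (multipartite G j (D * suc t) dense deg (m+n≤o⇒m≤o _ bound)) dense deg
    (m+n≤o⇒n≤o (multipartiteBound D j (D * suc t)) bound)

multipartite G zero t dense deg bound = record
  { vertex    = λ _ i → inject≤ i bound
  ; injective = λ _ → inject≤-injective bound bound _ _
  ; complete  = λ { {zero} {zero} ne → ⊥-elim (ne refl) }
  }
multipartite G {A} {D} (suc j) t dense deg bound = erdősStone G j t dense′ deg bound
  where
  open ≤-Reasoning
  dense′ : j * D + 1 ≤ suc j * A
  -- Subtracting `A ≤ D` from `dense` turns A / D > (j + 1) / (j + 2) into A / D > j / (j + 1); for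
  -- `A > D` the latter is immediate.
  dense′ with A ℕ.≤? D
  ... | yes A≤D = +-cancelˡ-≤ D _ _ (begin
    D + (j * D + 1)       ≡⟨ +-assoc D (j * D) 1 ⟨
    suc j * D + 1         ≤⟨ dense ⟩
    A + suc j * A         ≤⟨ +-monoˡ-≤ (suc j * A) A≤D ⟩
    D + suc j * A         ∎)
  ... | no A≰D = begin
    j * D + 1             ≡⟨ +-comm (j * D) 1 ⟩
    1 + j * D             ≤⟨ +-mono-≤ (≤-trans (s≤s z≤n) (≰⇒> A≰D)) (*-monoʳ-≤ j (<⇒≤ (≰⇒> A≰D))) ⟩
    suc j * A             ∎

-- Blowups of a universal graph, and VC-dimension

row : ∀ N G → order G ≤ N → Vertex G → Fin N → Bool
row N G n≤N v k with toℕ k ℕ.<? order G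
... | yes k<n = adj G v (fromℕ< k<n)
... | no  _   = false

row-inject : ∀ N G (n≤N : order G ≤ N) v u → row N G n≤N v (inject≤ u n≤N) ≡ adj G v u
row-inject N G n≤N v u with toℕ (inject≤ u n≤N) ℕ.<? order G
... | yes k<n = cong (adj G v) (Fin.toℕ-injective (trans (Fin.toℕ-fromℕ< k<n) (Fin.toℕ-inject≤ u n≤N)))
... | no  k≮n = contradiction (subst (_< order G) (sym (Fin.toℕ-inject≤ u n≤N)) (Fin.toℕ<n u)) k≮n

-- A vertex is an index together with a row of an adjacency matrix.
universal : ℕ → Graph
universal N = record
  { order  = N * 2 ^ N
  ; adj    = λ u v → edge (remQuot (2 ^ N) u) (remQuot (2 ^ N) v)
  ; symm   = λ u v → edge-sym (remQuot (2 ^ N) u) (remQuot (2 ^ N) v)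
  ; irrefl = λ u → edge-irrefl (remQuot (2 ^ N) u)
  }
  module Universal where
  edge : Fin N × Fin (2 ^ N) → Fin N × Fin (2 ^ N) → Bool
  -- Requiring both matrix entries makes the relation symmetric for arbitrary rows.
  edge (i , ρ) (j , τ) = not ⌊ i Fin.≟ j ⌋ ∧ (decode ρ j ∧ decode τ i)
  edge-sym : ∀ u v → edge u v ≡ edge v u
  edge-sym (i , ρ) (j , τ) with i Fin.≟ j | j Fin.≟ i
  ... | yes _   | yes _   = refl
  ... | no _    | no _    = ∧-comm (decode ρ j) (decode τ i)
  ... | yes i≡j | no j≢i  = contradiction (sym i≡j) j≢i
  ... | no i≢j  | yes j≡i = contradiction (sym j≡i) i≢j
  edge-irrefl : ∀ u → edge u u ≡ false
  edge-irrefl (i , ρ) with i Fin.≟ i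
  ... | yes _ = refl
  ... | no ne = contradiction refl ne

-- Sending `v` to its own index and row embeds G as an induced subgraph; the vertices of
-- `universal N` outside the image are blown up to empty sets.
blowup-universal : ∀ N G → order G ≤ N → G IsBlowupOf universal N
blowup-universal N G n≤N = record
  { part     = λ v → combine (inject≤ v n≤N) (code (row N G n≤N v))
  ; adj-part = λ u v → sym (begin
      edge (remQuot (2 ^ N) (combine (i u) (ρ u))) (remQuot (2 ^ N) (combine (i v) (ρ v)))
        ≡⟨ cong₂ edge (remQuot-combine (i u) (ρ u)) (remQuot-combine (i v) (ρ v)) ⟩
      not ⌊ i u Fin.≟ i v ⌋ ∧ (decode (ρ u) (i v) ∧ decode (ρ v) (i u))
        ≡⟨ cong₂ (λ a b → not ⌊ i u Fin.≟ i v ⌋ ∧ (a ∧ b)) (entry u v) (trans (entry v u) (symm G v u)) ⟩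
      not ⌊ i u Fin.≟ i v ⌋ ∧ (adj G u v ∧ adj G u v)
        ≡⟨ simplify u v ⟩
      adj G u v ∎)
  }
  where
  open ≡-Reasoning
  open Universal N
  i : Vertex G → Fin N
  i v = inject≤ v n≤N
  ρ : Vertex G → Fin (2 ^ N)
  ρ v = code (row N G n≤N v)
  entry : ∀ u v → decode (ρ u) (i v) ≡ adj G u v
  entry u v = trans (decode-code (row N G n≤N u) (i v)) (row-inject N G n≤N u v)
  simplify : ∀ u v → not ⌊ i u Fin.≟ i v ⌋ ∧ (adj G u v ∧ adj G u v) ≡ adj G u v
  simplify u v with i u Fin.≟ i v
  ... | no _   = ∧-idem (adj G u v)
  ... | yes eq = trans (sym (irrefl G u)) (cong (adj G u) (inject≤-injective n≤N n≤N u v eq))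

cardinality-inj : ∀ {n k} (S : Subset n) (f : Fin n → Fin k) → (∀ {u v} → u ∈ S → v ∈ S → f u ≡ f v → u ≡ v) → ∣ S ∣ ≤ k
cardinality-inj S f inj with count-enumerate (lookup S)
... | e , e-inj , mem = subst (_≤ _) (trans (sym (cardinality-tabulate (lookup S))) (cong ∣_∣ (tabulate∘lookup S)))
  (injective⇒≤ {f = f ∘ e} (λ {a} {b} eq → e-inj (inj (member a) (member b) eq)))
  where
  member : ∀ a → e a ∈ S
  member a = lookup⇒[]= (e a) S (T⇒≡ (mem a))

∈-nbhd : ∀ G {u v} → v ∈ nbhd G u → Adj G u v
∈-nbhd G {u} {v} m = subst T (trans (sym ([]=⇒lookup m)) (lookup∘tabulate (adj G u) v)) tt

∈-nbhd⁺ : ∀ G {u v} → Adj G u v → v ∈ nbhd G u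
∈-nbhd⁺ G {u} {v} e = lookup⇒[]= v (nbhd G u) (trans (lookup∘tabulate (adj G u) v) (T⇒≡ e))

-- Some `w` has trace `⁅ u ⁆` on `S`. Vertices in one part have the same neighbours, so `w` is also
-- adjacent to `v`, and `v` lies in that trace.
shattered⇒separated : ∀ G F (b : G IsBlowupOf F) S → Shattered G S →
  ∀ {u v} → u ∈ S → v ∈ S → _IsBlowupOf_.part b u ≡ _IsBlowupOf_.part b v → u ≡ v
shattered⇒separated G F b S sh {u} {v} u∈S v∈S eq
  with sh ⁅ u ⁆ (λ w∈ → subst (_∈ S) (sym (x∈⁅y⁆⇒x≡y u w∈)) u∈S)
... | w , trace = sym (x∈⁅y⁆⇒x≡y u (subst (v ∈_) trace (x∈p∩q⁺ (∈-nbhd⁺ G w~v , v∈S))))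
  where
  open _IsBlowupOf_ b
  w~u : Adj G w u
  w~u = ∈-nbhd G (proj₁ (x∈p∩q⁻ (nbhd G w) S (subst (u ∈_) (sym trace) (x∈⁅x⁆ u))))
  w~v : Adj G w v
  w~v = subst T (trans (adj-part w u) (trans (cong (adj F (part w)) eq) (sym (adj-part w v)))) w~u

blowup⇒VC≤ : ∀ G F → G IsBlowupOf F → VC G ≤ order F
blowup⇒VC≤ G F b = max≤v⁺ {xs = filter (shattersSize? G) (upTo (suc (order G)))} z≤n (All.tabulate λ {d} d∈ → bound (proj₂ (∈-filter⁻ (shattersSize? G) {xs = upTo (suc (order G))} d∈)))
  where
  bound : ∀ {d} → ShattersSize G d → d ≤ order F
  bound (S , sh , refl) = cardinality-inj S (_IsBlowupOf_.part b) (shattered⇒separated G F b S sh)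

δ-VC≤δ-B : ∀ H → δ-VC H ≤ᴿ δ-B H
δ-VC≤δ-B H q (γ , (0≤γ , F , bl) , γ<q) =
  γ , (0≤γ , order F , λ G max deg → blowup⇒VC≤ G F (bl G max deg)) , γ<q

shattersSize⇒≤VC : ∀ G {d} → ShattersSize G d → d ≤ VC G
shattersSize⇒≤VC G {d} sh@(S , _ , size) = All.lookup (xs≤max 0 (filter (shattersSize? G) (upTo (suc (order G)))))
  (∈-filter⁺ (shattersSize? G) (∈-upTo⁺ (s≤s (subst (_≤ order G) size (∣p∣≤n S)))) sh)

-- Rational degree conditions in natural numbers, and the upper bound for the blowup threshold

ratio : ℕ → ℕ → ℚ.ℚ
ratio a d = ℤ.+ a ℚ./ suc d

private
  toℚᵘ-ratio : ∀ a d → ℚ.toℚᵘ (ratio a d) ℚᵘ.≃ mkℚᵘ (ℤ.+ a) d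
  toℚᵘ-ratio a d = ℚ.toℚᵘ-fromℚᵘ (mkℚᵘ (ℤ.+ a) d)

  toℚᵘ-ratio* : ∀ a d n → ℚ.toℚᵘ (ratio a d ℚ.* fromℕ n) ℚᵘ.≃ mkℚᵘ (ℤ.+ a) d ℚᵘ.* mkℚᵘ (ℤ.+ n) 0
  toℚᵘ-ratio* a d n = ℚᵘ.≃-trans (ℚ.toℚᵘ-homo-* (ratio a d) (fromℕ n))
    (ℚᵘ.*-cong (toℚᵘ-ratio a d) (toℚᵘ-ratio n 0))

  numerator≡ : ∀ a n → (ℤ.+ a ℤ.* ℤ.+ n) ℤ.* ℤ.+ 1 ≡ ℤ.+ (a * n)
  numerator≡ a n = trans (ℤ.*-identityʳ _) (sym (ℤ.pos-* a n))

  denominator≡ : ∀ d k → ℤ.+ k ℤ.* ℤ.+ (suc d * 1) ≡ ℤ.+ (suc d * k)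
  denominator≡ d k = trans (sym (ℤ.pos-* k (suc d * 1)))
    (cong ℤ.+_ (trans (cong (k *_) (*-identityʳ (suc d))) (*-comm k (suc d))))

ratio*≤⁻ : ∀ a d n k → ratio a d ℚ.* fromℕ n ℚ.≤ fromℕ k → a * n ≤ suc d * k
ratio*≤⁻ a d n k le = ℤ.drop‿+≤+ (subst₂ ℤ._≤_ (numerator≡ a n) (denominator≡ d k) (ℚᵘ.drop-*≤*
  (ℚᵘ.≤-respˡ-≃ (toℚᵘ-ratio* a d n) (ℚᵘ.≤-respʳ-≃ (toℚᵘ-ratio k 0) (ℚ.toℚᵘ-mono-≤ le)))))

ratio*≤⁺ : ∀ a d n k → a * n ≤ suc d * k → ratio a d ℚ.* fromℕ n ℚ.≤ fromℕ k
ratio*≤⁺ a d n k le = ℚ.toℚᵘ-cancel-≤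
  (ℚᵘ.≤-respˡ-≃ (ℚᵘ.≃-sym (toℚᵘ-ratio* a d n)) (ℚᵘ.≤-respʳ-≃ (ℚᵘ.≃-sym (toℚᵘ-ratio k 0))
    (ℚᵘ.*≤* (subst₂ ℤ._≤_ (sym (numerator≡ a n)) (sym (denominator≡ d k)) (ℤ.+≤+ le)))))

ratio-< : ∀ a d a′ d′ → a * suc d′ < a′ * suc d → ratio a d ℚ.< ratio a′ d′
ratio-< a d a′ d′ lt = ℚ.toℚᵘ-cancel-<
  (ℚᵘ.<-respˡ-≃ (ℚᵘ.≃-sym (toℚᵘ-ratio a d)) (ℚᵘ.<-respʳ-≃ (ℚᵘ.≃-sym (toℚᵘ-ratio a′ d′))
    (ℚᵘ.*<* (subst₂ ℤ._<_ (ℤ.pos-* a (suc d′)) (ℤ.pos-* a′ (suc d)) (ℤ.+<+ lt)))))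

0≤ratio : ∀ a d → ℚ.0ℚ ℚ.≤ ratio a d
0≤ratio a d = ℚ.nonNegative⁻¹ (ratio a d) {{ℚ.normalize-nonNeg a (suc d)}}

-- The hypothesis says a / (d + 1) > j / (j + 1).
dense⇒boundsBlowup : ∀ H {a d} j → Colourable H (suc (suc j)) → j * suc d + 1 ≤ suc j * a →
                     BoundsBlowup H (ratio a d)
dense⇒boundsBlowup H {a} {d} j col dense =
  0≤ratio a d , universal N , λ G (free , _) deg → blowup-universal N G (order≤N G free deg)
  where
  -- A graph of larger order contains a complete (j + 2)-partite graph with parts of size `order H`,
  -- hence `H`. The graphs that remain have bounded order and are blowups of one universal graph.
  N : ℕ
  N = multipartiteBound (suc d) (suc j) (order H)
  order≤N : ∀ G → H -free G → MinDegreeAtLeast (ratio a d) G → order G ≤ N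
  order≤N G free deg with order G ℕ.≤? N
  ... | yes le = le
  ... | no  gt = contradiction (colourable⇒⊆multipartite H G col
    (erdősStone G j (order H) dense (λ v → ≤-trans (ratio*≤⁻ a d (order G) (minDegree G) deg) (*-monoʳ-≤ (suc d) (minDegree≤degree G v)))
      (<⇒≤ (≰⇒> gt)))) free

-- Homomorphisms between induced subgraphs

-- Vertex sets S stand for the induced subgraphs H[S].
module Induced (H : Graph) (m : ℕ) where

  V : Set
  V = Vertex H

  VSet : Set
  VSet = V → Bool

  -- Total functions, with arbitrary values outside `S`, can be composed and numbered without
  -- membership proofs.
  record Hom (S S′ : VSet) : Set where
    field
      fun  : V → V
      maps : ∀ {v} → T (S v) → T (S′ (fun v))
      edge : ∀ {u v} → T (S u) → T (S v) → Adj H u v → Adj H (fun u) (fun v)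

  open Hom public

  idHom : ∀ {S S′} → (∀ v → T (S v) → T (S′ v)) → Hom S S′
  idHom sub = record { fun = id ; maps = λ {v} → sub v ; edge = λ _ _ e → e }

  infixr 9 _∘ᴴ_

  _∘ᴴ_ : ∀ {S S′ S″} → Hom S′ S″ → Hom S S′ → Hom S S″
  g ∘ᴴ f = record
    { fun  = fun g ∘ fun f
    ; maps = maps g ∘ maps f
    ; edge = λ u∈ v∈ e → edge g (maps f u∈) (maps f v∈) (edge f u∈ v∈ e)
    }

  InJoin : VSet → V ⊎ Fin m → Set
  InJoin S (inj₁ v) = T (S v)
  InJoin S (inj₂ _) = ⊤

  JoinAdj : V ⊎ Fin m → V ⊎ Fin m → Set
  JoinAdj (inj₁ u) (inj₁ v) = Adj H u v
  JoinAdj (inj₂ p) (inj₂ q) = p ≢ q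
  JoinAdj _        _        = ⊤

  -- A homomorphism from H to the join of H[S] with the complete graph on m vertices.
  record Target (S : VSet) : Set where
    field
      to       : V → V ⊎ Fin m
      to-in    : ∀ v → InJoin S (to v)
      to-edge  : ∀ {u v} → Adj H u v → JoinAdj (to u) (to v)

  open Target public

  target-∘ : ∀ {S S′} → Hom S S′ → Target S → Target S′
  target-∘ {S} {S′} f t = record
    { to      = Sum.map₁ (fun f) ∘ to t
    ; to-in   = λ v → in′ (to t v) (to-in t v)
    ; to-edge = λ {u} {v} e → edge′ (to t u) (to t v) (to-in t u) (to-in t v) (to-edge t e)
    }
    where
    in′ : ∀ a → InJoin S a → InJoin S′ (Sum.map₁ (fun f) a)
    in′ (inj₁ a) a∈ = maps f a∈
    in′ (inj₂ _) _  = tt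
    edge′ : ∀ a b → InJoin S a → InJoin S b → JoinAdj a b → JoinAdj (Sum.map₁ (fun f) a) (Sum.map₁ (fun f) b)
    edge′ (inj₁ a) (inj₁ b) a∈ b∈ e = edge f a∈ b∈ e
    edge′ (inj₁ _) (inj₂ _) _  _  _ = tt
    edge′ (inj₂ _) (inj₁ _) _  _  _ = tt
    edge′ (inj₂ _) (inj₂ _) _  _  e = e

  E : VSet → V → V → Set
  E S u v = T (S u) × T (S v) × Adj H u v

  E? : ∀ S u v → Dec (E S u v)
  E? S u v = T? (S u) ×-dec T? (S v) ×-dec T? (adj H u v)

  E-sym : ∀ S {u v} → E S u v → E S v u
  E-sym S (u∈ , v∈ , e) = v∈ , u∈ , Adj-sym H e

  Bicolouring : VSet → (V → Bool) → Set
  Bicolouring S f = ∀ u v → E S u v → f u ≢ f v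

  -- Two colours for H[S] and `m` further ones for the complete graph colour the join; the colouring
  -- is pulled back to H. The contrapositive makes H[S] non-bipartite.
  bicoloured⇒colourable : ∀ {S} → Target S → ∃ (Bicolouring S) →
                          Colourable H (suc (suc m))
  bicoloured⇒colourable {S} t (f , proper) = colour , λ u v e eq → clash (to t u) (to t v) (to-in t u) (to-in t v) (to-edge t e)
      (trans (sym (Fin.splitAt-join 2 m (tone (to t u)))) (trans (cong (Fin.splitAt 2) eq) (Fin.splitAt-join 2 m (tone (to t v)))))
    where
    tone : V ⊎ Fin m → Fin 2 ⊎ Fin m
    tone = Sum.map₁ (bit ∘ f)
    colour : V → Fin (suc (suc m))
    colour v = Fin.join 2 m (tone (to t v))
    clash : ∀ a b → InJoin S a → InJoin S b → JoinAdj a b → tone a ≢ tone b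
    clash (inj₁ a) (inj₁ b) a∈ b∈ e eq = proper a b (a∈ , b∈ , e) (bit-injective (inj₁-inj eq))
      where
      inj₁-inj : ∀ {A B : Set} {x y : A} → inj₁ {B = B} x ≡ inj₁ y → x ≡ y
      inj₁-inj refl = refl
    clash (inj₁ _) (inj₂ _) _ _ _ ()
    clash (inj₂ _) (inj₁ _) _ _ _ ()
    clash (inj₂ p) (inj₂ q) _ _ p≢q eq = p≢q (inj₂-inj eq)
      where
      inj₂-inj : ∀ {A B : Set} {x y : B} → inj₂ {A = A} x ≡ inj₂ y → x ≡ y
      inj₂-inj refl = refl

  _⊊_ : VSet → VSet → Set
  S′ ⊊ S = (∀ v → T (S′ v) → T (S v)) × ∃[ v ] (T (S v) × ¬ T (S′ v))

  infix 4 _⊏_ _⊊_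

  -- The second alternative breaks ties between homomorphically equivalent sets, so that minimal
  -- elements are cores.
  _⊏_ : VSet → VSet → Set
  S′ ⊏ S = Hom S′ S × (¬ Hom S S′ ⊎ S′ ⊊ S)

  ⊏-irrefl : ∀ {S} → ¬ (S ⊏ S)
  ⊏-irrefl (h , inj₁ ¬h)                  = ¬h h
  ⊏-irrefl (h , inj₂ (_ , v , v∈ , v∉)) = v∉ v∈

  ⊏-trans : ∀ {S S′ S″} → S ⊏ S′ → S′ ⊏ S″ → S ⊏ S″
  ⊏-trans (f , inj₁ ¬h) (g , _)        = g ∘ᴴ f , inj₁ (λ h → ¬h (h ∘ᴴ g))
  ⊏-trans (f , inj₂ _)  (g , inj₁ ¬h)  = g ∘ᴴ f , inj₁ (λ h → ¬h (f ∘ᴴ h))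
  ⊏-trans (f , inj₂ (s , _)) (g , inj₂ (s′ , v , v∈ , v∉)) =
    g ∘ᴴ f , inj₂ ((λ w → s′ w ∘ s w) , v , v∈ , v∉ ∘ s v)

  -- Decoding the code of a set returns it only up to pointwise equality.
  ⊏-respˡ : ∀ {S S₁ S₂} → (∀ v → S₁ v ≡ S₂ v) → S₁ ⊏ S → S₂ ⊏ S
  ⊏-respˡ eq (f , strict) = f ∘ᴴ idHom (λ v → subst T (sym (eq v))) , strict′ strict
    where
    strict′ : _ → _
    strict′ (inj₁ ¬h) = inj₁ (λ h → ¬h (idHom (λ v → subst T (sym (eq v))) ∘ᴴ h))
    strict′ (inj₂ (s , v , v∈ , v∉)) = inj₂ ((λ w → s w ∘ subst T (sym (eq w))) , v , v∈ , v∉ ∘ subst T (sym (eq v)))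

  Minimal : VSet → Set
  Minimal S = ∀ S′ → S′ ⊏ S → ¬ Target S′

  private
    _⊏ᶜ_ : Fin (2 ^ order H) → Fin (2 ^ order H) → Set
    i ⊏ᶜ j = decode i ⊏ decode j

    ⊏ᶜ-wellFounded : WellFounded _⊏ᶜ_
    ⊏ᶜ-wellFounded = spo-wellFounded {_≈_ = _≡_} record
      { isEquivalence = isEquivalence
      ; irrefl        = λ { refl → ⊏-irrefl }
      ; trans         = ⊏-trans
      ; <-resp-≈      = (λ { refl → id }) , (λ { refl → id })
      }

  -- Well-founded descent on codes, from the whole vertex set with the identity of H as target.
  -- `Target` is never decided, hence the double negation; the result is used to refute a statement.
  minimal-target : ¬ ¬ (∃ λ S → Target S × Minimal S)
  minimal-target none = descend (⊏ᶜ-wellFounded (code {order H} (λ _ → true)))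
      (target-∘ (idHom (λ v _ → subst T (sym (decode-code (λ _ → true) v)) tt)) everything)
    where
    everything : Target (λ _ → true)
    everything = record { to = inj₁ ; to-in = λ _ → tt ; to-edge = id }
    descend : ∀ {i} → Acc _⊏ᶜ_ i → ¬ Target (decode i)
    descend {i} (acc rec) t = none (decode i , t , λ S′ S′⊏ t′ →
      descend (rec {code S′} (⊏-respˡ (λ v → sym (decode-code S′ v)) S′⊏))
        (target-∘ (idHom (λ v → subst T (sym (decode-code S′ v)))) t′))

  module Core (S : VSet) (target : Target S) (minimal : Minimal S) where

    -- Otherwise `S′` would lie strictly below `S` by the first alternative of `_⊏_`.
    hom-back : ∀ {S′} → Target S′ → Hom S′ S → ¬ ¬ Hom S S′
    hom-back t h ¬h = minimal _ (h , inj₁ ¬h) t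

    -- If `σ` missed `v`, it would map into `S` without `v`, a proper subset and therefore a smaller
    -- target.
    surjective : (σ : Hom S S) → ∀ v → T (S v) → ∃[ u ] (T (S u) × fun σ u ≡ v)
    surjective σ v v∈ with any? (λ u → T? (S u) ×-dec (fun σ u Fin.≟ v))
    ... | yes found = found
    ... | no  none  = ⊥-elim (minimal S′ (idHom S′⊆S , inj₂ (S′⊆S , v , v∈ , v∉)) (target-∘ avoid target))
      where
      S′ : VSet
      S′ w = S w ∧ not ⌊ w Fin.≟ v ⌋
      S′⊆S : ∀ w → T (S′ w) → T (S w)
      S′⊆S w = T-∧ˡ
      v∉ : ¬ T (S′ v)
      v∉ t with v Fin.≟ v | T-∧ʳ {S v} t
      ... | yes _ | ()
      ... | no ne | _ = ne refl
      keep : ∀ {w} → w ≢ v → T (not ⌊ w Fin.≟ v ⌋)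
      keep {w} w≢v with w Fin.≟ v
      ... | yes eq = w≢v eq
      ... | no _   = tt
      avoid : Hom S S′
      avoid = record
        { fun  = fun σ
        ; maps = λ {u} u∈ → T-∧⁺ (maps σ u∈) (keep (λ eq → none (u , u∈ , eq)))
        ; edge = edge σ
        }

    power : Hom S S → ℕ → Hom S S
    power σ zero    = idHom (λ _ → id)
    power σ (suc k) = σ ∘ᴴ power σ k

    power-+ : ∀ σ k l v → fun (power σ (k + l)) v ≡ fun (power σ k) (fun (power σ l) v)
    power-+ σ zero    l v = refl
    power-+ σ (suc k) l v = cong (fun σ) (power-+ σ k l v)

    -- Two powers of σ coincide; as powers are surjective, some positive power is the identity.
    invertible : (σ : Hom S S) → ∃[ τ ] (∀ v → T (S v) → fun σ (fun {S} {S} τ v) ≡ v)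
    invertible σ with pigeonhole (n<1+n (order H ^ order H)) (λ k → funToFin (fun (power σ (toℕ k))))
    ... | i , j , i<j , eq with m≤n⇒∃[o]m+o≡n i<j
    -- Here `suc l` is j - i, so `σ` after `power σ l` is the power with exponent j - i.
    ... | l , i+1+l≡j = power σ l , λ v v∈ → let (u , u∈ , iu≡v) = surjective (power σ (toℕ i)) v v∈ in begin
        fun (power σ (suc l)) v                              ≡⟨ cong (fun (power σ (suc l))) (sym iu≡v) ⟩
        fun (power σ (suc l)) (fun (power σ (toℕ i)) u)      ≡⟨ sym (power-+ σ (suc l) (toℕ i) u) ⟩
        fun (power σ (suc l + toℕ i)) u                      ≡⟨ cong (λ k → fun (power σ k) u) (trans (cong suc (+-comm l (toℕ i))) i+1+l≡j) ⟩
        fun (power σ (toℕ j)) u                              ≡⟨ same u ⟨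
        fun (power σ (toℕ i)) u                              ≡⟨ iu≡v ⟩
        v                                                    ∎
      where
      open ≡-Reasoning
      same : ∀ u → fun (power σ (toℕ i)) u ≡ fun (power σ (toℕ j)) u
      same u = trans (sym (finToFun-funToFin (fun (power σ (toℕ i))) u))
        (trans (cong (λ c → finToFun c u) eq) (finToFun-funToFin (fun (power σ (toℕ j))) u))

  -- xy is not a bridge of H[S], in the form: no set U separates x from y in H[S] − xy.
  NoCut : VSet → V → V → Set
  NoCut S x y = ∀ (U : VSet) → T (U x) → ¬ T (U y) →
    ¬ (∀ a b → E S a b → ¬ (a ≡ x × b ≡ y) → ¬ (a ≡ y × b ≡ x) → U a ≡ U b)

  private
    xor-≢ : ∀ {a b c d} → a ≢ b → c ≡ d → a xor c ≢ b xor d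
    xor-≢ {false} {false} ne _    _ = ne refl
    xor-≢ {true}  {true}  ne _    _ = ne refl
    xor-≢ {false} {true}  {false} ne refl ()
    xor-≢ {false} {true}  {true}  ne refl ()
    xor-≢ {true}  {false} {false} ne refl ()
    xor-≢ {true}  {false} {true}  ne refl ()

    xor-≢′ : ∀ {a b c d} → a ≡ b → T c → ¬ T d → a xor c ≢ b xor d
    xor-≢′ {d = true}                refl _ nd _ = nd tt
    xor-≢′ {false} {c = true} {false} refl _ nd ()
    xor-≢′ {true}  {c = true} {false} refl _ nd ()

  -- Adding the edges one by one, the first one that destroys 2-colourability joins two
  -- vertices of the same component: otherwise flip the colours on one side of the cut.
  nonBridge : ∀ S → ¬ ∃ (Bicolouring S) → ¬ ¬ (∃₂ λ x y → E S x y × NoCut S x y)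
  nonBridge S odd none = colour (cartesianProduct (allFin _) (allFin _))
      λ (f , proper) → odd (f , λ u v e → proper u v (∈-cartesianProduct⁺ (∈-allFin u) (∈-allFin v)) e)
    where
    ColoursOn : List (V × V) → (V → Bool) → Set
    ColoursOn L f = ∀ u v → (u , v) ∈ˡ L → E S u v → f u ≢ f v
    colour : ∀ L → ¬ ¬ ∃ (ColoursOn L)
    colour []            k = k ((λ _ → true) , λ _ _ ())
    colour ((x , y) ∷ L) k = colour L extend
      where
      extend : ¬ ∃ (ColoursOn L)
      extend (f , proper) with E? S x y
      ... | no  ¬e = k (f , λ { u v (here refl) e → ⊥-elim (¬e e) ; u v (there uv∈) e → proper u v uv∈ e })
      ... | yes e with f x Bool.≟ f y
      ...   | no  ne = k (f , λ { u v (here refl) _ → ne ; u v (there uv∈) e → proper u v uv∈ e })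
      ...   | yes eq = none (x , y , e , λ U Ux ¬Uy respects → k ((λ v → f v xor U v) , flipped U Ux ¬Uy respects))
        where
        flipped : ∀ U → T (U x) → ¬ T (U y) →
                  (∀ a b → E S a b → ¬ (a ≡ x × b ≡ y) → ¬ (a ≡ y × b ≡ x) → U a ≡ U b) →
                  ∀ u v → (u , v) ∈ˡ ((x , y) ∷ L) → E S u v → f u xor U u ≢ f v xor U v
        flipped U Ux ¬Uy respects u v (here refl) _ = xor-≢′ eq Ux ¬Uy
        flipped U Ux ¬Uy respects u v (there uv∈) uv = xor-≢ (proper u v uv∈ uv) (respects u v uv
          -- An edge of `L` is not `xy`: `f` separates its ends, but not `x` and `y`.
          (λ { (refl , refl) → proper u v uv∈ uv eq })
          (λ { (refl , refl) → proper u v uv∈ uv (sym eq) }))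

-- The pattern and its gadgets

module Gadgets (H : Graph) (m : ℕ) (S : Vertex H → Bool) (x y : Vertex H)
               (xy : Induced.E H m S x y) {d D : ℕ} (P : Fin d → Fin D → Bool) where

  open Induced H m

  -- The vertices before blowing up: `full p` is a part of the complete `m`-partite graph, `blobA c`
  -- and `blobB c` are the sides of the bipartite graph of index `c`, and the sparse classes lie
  -- over `c`. For every `j`, `sparse x i j` plays the role of x_i; for every `i`, `sparse y i j`
  -- that of y_j.
  data Class : Set where
    full   : Fin m → Class
    blobA  : V → Class
    blobB  : V → Class
    sparse : V → Fin d → Fin D → Class

  -- The vertex x_i is shared by the gadgets of all (i , j₀), and y_j by those of all (i₀ , j), so
  -- only one index is tested for these two.
  InGadget : Fin d → Fin D → V → Fin d → Fin D → Set
  InGadget i₀ j₀ c i j = (c ≡ y ⊎ i ≡ i₀) × (c ≡ x ⊎ j ≡ j₀)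

  data Link (c : V) (i : Fin d) (j : Fin D) (c′ : V) (i′ : Fin d) (j′ : Fin D) : Set where
    patternEdge : c ≡ x → c′ ≡ y → T (P i j′) → Link c i j c′ i′ j′
    gadget     : ∀ i₀ j₀ → ¬ T (P i₀ j₀) → InGadget i₀ j₀ c i j → InGadget i₀ j₀ c′ i′ j′ →
                 ¬ (c ≡ x × c′ ≡ y) → ¬ (c ≡ y × c′ ≡ x) → Link c i j c′ i′ j′

  link? : ∀ c i j c′ i′ j′ → Dec (Link c i j c′ i′ j′)
  link? c i j c′ i′ j′ = map′
    (λ { (inj₁ (p , q , r)) → patternEdge p q r ; (inj₂ (i₀ , j₀ , p , q , r , s , t)) → gadget i₀ j₀ p q r s t })
    (λ { (patternEdge p q r) → inj₁ (p , q , r) ; (gadget i₀ j₀ p q r s t) → inj₂ (i₀ , j₀ , p , q , r , s , t) })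
    (((c Fin.≟ x) ×-dec (c′ Fin.≟ y) ×-dec T? (P i j′)) ⊎-dec
     any? λ i₀ → any? λ j₀ → ¬? (T? (P i₀ j₀)) ×-dec inGadget? i₀ j₀ c i j ×-dec inGadget? i₀ j₀ c′ i′ j′ ×-dec
       ¬? ((c Fin.≟ x) ×-dec (c′ Fin.≟ y)) ×-dec ¬? ((c Fin.≟ y) ×-dec (c′ Fin.≟ x)))
    where
    inGadget? : ∀ i₀ j₀ c i j → Dec (InGadget i₀ j₀ c i j)
    inGadget? i₀ j₀ c i j = ((c Fin.≟ y) ⊎-dec (i Fin.≟ i₀)) ×-dec ((c Fin.≟ x) ⊎-dec (j Fin.≟ j₀))

  -- Each kind of adjacency is listed in one direction. Towards `blobB c`, the sparse classes over
  -- `c` behave like `blobA c`.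
  Arc : Class → Class → Set
  Arc (full p)       (full q)          = p ≢ q
  Arc (full _)       _                 = ⊤
  Arc (blobA c)      (blobB c′)        = c ≡ c′
  Arc (sparse c _ _) (blobB c′)        = c ≡ c′
  Arc (sparse c i j) (sparse c′ i′ j′) = E S c c′ × Link c i j c′ i′ j′
  Arc _              _                 = ⊥

  arc? : ∀ u v → Dec (Arc u v)
  arc? (full p)       (full q)          = ¬? (p Fin.≟ q)
  arc? (full _)       (blobA _)         = yes tt
  arc? (full _)       (blobB _)         = yes tt
  arc? (full _)       (sparse _ _ _)    = yes tt
  arc? (blobA c)      (blobB c′)        = c Fin.≟ c′
  arc? (sparse c _ _) (blobB c′)        = c Fin.≟ c′
  arc? (sparse c i j) (sparse c′ i′ j′) = E? S c c′ ×-dec link? c i j c′ i′ j′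
  arc? (blobA _)      (full _)          = no λ ()
  arc? (blobA _)      (blobA _)         = no λ ()
  arc? (blobA _)      (sparse _ _ _)    = no λ ()
  arc? (blobB _)      (full _)          = no λ ()
  arc? (blobB _)      (blobA _)         = no λ ()
  arc? (blobB _)      (blobB _)         = no λ ()
  arc? (blobB _)      (sparse _ _ _)    = no λ ()
  arc? (sparse _ _ _) (full _)          = no λ ()
  arc? (sparse _ _ _) (blobA _)         = no λ ()

  arc-irrefl : ∀ u → ¬ Arc u u
  arc-irrefl (full p)       p≢p                    = p≢p refl
  arc-irrefl (sparse c i j) ((_ , _ , cc) , _) = Adj-irrefl H cc refl

  ClassAdj : Class → Class → Set
  ClassAdj u v = Arc u v ⊎ Arc v u

  classAdj? : ∀ u v → Dec (ClassAdj u v)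
  classAdj? u v = arc? u v ⊎-dec arc? v u

  Partner : V → Set
  Partner c = ∃ (E S c)

  partner? : ∀ c → Dec (Partner c)
  partner? c = any? (E? S c)

  -- Every class except the full ones lies over an edge end of H[S]: a class with index c lies
  -- over c, and blobB c over a neighbour of c. The vertices c that are isolated in H[S] or lie
  -- outside S are moved to x.
  anchor : V → ∃₂ (E S)
  anchor c with partner? c
  ... | yes (c′ , e) = c , c′ , e
  ... | no  _        = x , y , xy

  ρ ν : V → V
  ρ c = proj₁ (anchor c)
  ν c = proj₁ (proj₂ (anchor c))

  ρν : ∀ c → E S (ρ c) (ν c)
  ρν c = proj₂ (proj₂ (anchor c))

  ρ≡ : ∀ {c} → Partner c → ρ c ≡ c
  ρ≡ {c} p with partner? c
  ... | yes _  = refl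
  ... | no  ¬p = contradiction p ¬p

  -- A homomorphism to H[S] away from the full classes, where the value is a default.
  π : Class → V
  π (full _)       = x
  π (blobA c)      = ρ c
  π (blobB c)      = ν c
  π (sparse c _ _) = ρ c

  π∈S : ∀ u → T (S (π u))
  π∈S (full _)       = proj₁ xy
  π∈S (blobA c)      = proj₁ (ρν c)
  π∈S (blobB c)      = proj₁ (proj₂ (ρν c))
  π∈S (sparse c _ _) = proj₁ (ρν c)

  isFull : Class → Bool
  isFull (full _) = true
  isFull _        = false

  NonFull : Class → Set
  NonFull u = T (not (isFull u))

  π-arc : ∀ u v → NonFull u → Arc u v → E S (π u) (π v)
  π-arc (blobA c)      (blobB .c)        _ refl    = ρν c
  π-arc (sparse c _ _) (blobB .c)        _ refl    = ρν c
  π-arc (sparse c _ _) (sparse c′ _ _)   _ (e , _) =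
    subst₂ (E S) (sym (ρ≡ (c′ , e))) (sym (ρ≡ (c , E-sym S e))) e

  π-adj : ∀ u v → NonFull u → NonFull v → ClassAdj u v → E S (π u) (π v)
  π-adj u v nu nv (inj₁ a) = π-arc u v nu a
  π-adj u v nu nv (inj₂ a) = E-sym S (π-arc v u nv a)

  -- A section of π over H[S] would make U = {vertices in the gadgets of i} a cut of H[S] − xy,
  -- where φ x = sparse x i _.
  module Section (noCut : NoCut S x y) (φ : V → Class)
                 (nonFull : ∀ {c} → T (S c) → NonFull (φ c)) (πφ : ∀ {c} → T (S c) → π (φ c) ≡ c)
                 (φ-adj : ∀ {c c′} → E S c c′ → ClassAdj (φ c) (φ c′)) where

    private
      x≢y : x ≢ y
      x≢y = Adj-irrefl H (proj₂ (proj₂ xy))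

    -- The non-full neighbours of a blob class all have the same projection, so a vertex that the
    -- section sends into a blob has at most one neighbour in H[S]. Vertices outside `S` count as
    -- leaves too.
    data Kind (c : V) : Set where
      isSparse : ∀ i j → φ c ≡ sparse c i j → Kind c
      isLeaf   : ∀ w → (∀ c′ → E S c c′ → c′ ≡ w) → Kind c

    private
      blobA-nbr : ∀ c v → NonFull v → ClassAdj (blobA c) v → π v ≡ ν c
      blobA-nbr c (blobB .c) _ (inj₁ refl) = refl
      blobA-nbr c (blobB _)  _ (inj₂ ())

      blobB-nbr : ∀ c v → NonFull v → ClassAdj (blobB c) v → π v ≡ ρ c
      blobB-nbr c (blobA .c)      _ (inj₂ refl) = refl
      blobB-nbr c (sparse .c _ _) _ (inj₂ refl) = refl

      junk-nbr : ∀ c i j v → ¬ Partner c → NonFull v → ClassAdj (sparse c i j) v → π v ≡ ν c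
      junk-nbr c i j (blobB .c)        _  _ (inj₁ refl)    = refl
      junk-nbr c i j (sparse c′ _ _)   ¬p _ (inj₁ (e , _)) = contradiction (c′ , e) ¬p
      junk-nbr c i j (sparse c′ _ _)   ¬p _ (inj₂ (e , _)) = contradiction (c′ , E-sym S e) ¬p

    kind : ∀ c → Kind c
    kind c with T? (S c)
    ... | no  c∉ = isLeaf x (λ _ (c∈ , _) → contradiction c∈ c∉)
    ... | yes c∈ = byClass (φ c) refl
      where
      leaf : ∀ {w} u → φ c ≡ u → (∀ v → NonFull v → ClassAdj u v → π v ≡ w) → Kind c
      leaf {w} u eq nbr = isLeaf w λ c′ e → trans (sym (πφ (proj₁ (proj₂ e))))
        (nbr (φ c′) (nonFull (proj₁ (proj₂ e))) (subst (λ z → ClassAdj z (φ c′)) eq (φ-adj e)))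
      byClass : ∀ u → φ c ≡ u → Kind c
      byClass (full p)        eq with () ← subst NonFull eq (nonFull c∈)
      byClass (blobA c₀)      eq = leaf (blobA c₀) eq (blobA-nbr c₀)
      byClass (blobB c₀)      eq = leaf (blobB c₀) eq (blobB-nbr c₀)
      byClass (sparse c₀ i j) eq with partner? c₀
      -- As `c₀` has a partner, `c₀ = ρ c₀ = π (φ c) = c`.
      ... | yes p = isSparse i j (trans eq (cong (λ z → sparse z i j)
                      (trans (sym (ρ≡ p)) (trans (cong π (sym eq)) (πφ c∈)))))
      ... | no ¬p = leaf (sparse c₀ i j) eq (λ v → junk-nbr c₀ i j v ¬p)

    -- Otherwise `y` would be the only neighbour of `x`, and the set consisting of `x` alone would
    -- be a cut of H[S] - xy.
    x-not-leaf : ∀ w → ¬ (∀ c′ → E S x c′ → c′ ≡ w)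
    x-not-leaf w leaf = noCut (λ c → ⌊ c Fin.≟ x ⌋) (fromWitness refl) (λ t → x≢y (sym (toWitness t))) respects
      where
      y≡w : y ≡ w
      y≡w = leaf y xy
      respects : ∀ a b → E S a b → ¬ (a ≡ x × b ≡ y) → ¬ (a ≡ y × b ≡ x) → ⌊ a Fin.≟ x ⌋ ≡ ⌊ b Fin.≟ x ⌋
      respects a b e n₁ n₂ with a Fin.≟ x | b Fin.≟ x
      ... | yes refl | yes _    = refl
      ... | yes refl | no _     = contradiction (refl , trans (leaf b e) (sym y≡w)) n₁
      ... | no _     | yes refl = contradiction (trans (leaf a (E-sym S e)) (sym y≡w) , refl) n₂
      ... | no _     | no _     = refl

    y-not-leaf : ∀ w → ¬ (∀ c′ → E S y c′ → c′ ≡ w)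
    y-not-leaf w leaf = noCut (λ c → not ⌊ c Fin.≟ y ⌋) x∈ y∉ respects
      where
      x≡w : x ≡ w
      x≡w = leaf x (E-sym S xy)
      x∈ : T (not ⌊ x Fin.≟ y ⌋)
      x∈ with x Fin.≟ y
      ... | yes eq = x≢y eq
      ... | no _   = tt
      y∉ : ¬ T (not ⌊ y Fin.≟ y ⌋)
      y∉ with y Fin.≟ y
      ... | yes _ = λ ()
      ... | no ne = λ _ → ne refl
      respects : ∀ a b → E S a b → ¬ (a ≡ x × b ≡ y) → ¬ (a ≡ y × b ≡ x) → not ⌊ a Fin.≟ y ⌋ ≡ not ⌊ b Fin.≟ y ⌋
      respects a b e n₁ n₂ with a Fin.≟ y | b Fin.≟ y
      ... | yes refl | yes _    = refl
      ... | yes refl | no _     = contradiction (refl , trans (leaf b e) (sym x≡w)) n₂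
      ... | no _     | yes refl = contradiction (trans (leaf a (E-sym S e)) (sym x≡w) , refl) n₁
      ... | no _     | no _     = refl

    module Cut (i : Fin d) (j : Fin D) (Pij : T (P i j))
               (x-index : ∀ i′ j′ → φ x ≡ sparse x i′ j′ → i′ ≡ i)
               (y-index : ∀ i′ j′ → φ y ≡ sparse y i′ j′ → j′ ≡ j) where

      side : ∀ {c} → Kind c → Bool
      side {c} (isSparse i′ _ _) = ⌊ c Fin.≟ x ⌋ ∨ (not ⌊ c Fin.≟ y ⌋ ∧ ⌊ i′ Fin.≟ i ⌋)
      side     (isLeaf _ _)      = false

      -- A leaf takes the side of its only neighbour; two adjacent leaves both get `false`.
      side′ : ∀ {c} → Kind c → Bool
      side′ k@(isSparse _ _ _) = side k
      side′ (isLeaf w _)       = side (kind w)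

      U : V → Bool
      U c = side′ (kind c)

      -- A gadget lies on one side as a whole. If it contains the image of `x`, then `i₀ = i`; if it
      -- contains that of `y`, then `j₀ = j`, and `i₀ ≢ i` because (i , j) is an edge of the pattern
      -- but (i₀ , j₀) is not.
      side-gadget : ∀ {c i′ j′} i₀ j₀ (eq : φ c ≡ sparse c i′ j′) → ¬ T (P i₀ j₀) → InGadget i₀ j₀ c i′ j′ →
                    side (isSparse i′ j′ eq) ≡ ⌊ i₀ Fin.≟ i ⌋
      side-gadget {c} {i′} {j′} i₀ j₀ eq ¬P (in₁ , in₂) with c Fin.≟ x | c Fin.≟ y
      side-gadget {i′ = i′} {j′} i₀ j₀ eq ¬P (inj₁ refl , in₂) | yes refl | _ = contradiction refl x≢y
      side-gadget {i′ = i′} {j′} i₀ j₀ eq ¬P (inj₂ refl , in₂) | yes refl | _ with i₀ Fin.≟ i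
      ... | yes _ = refl
      ... | no ne = contradiction (x-index i₀ j′ eq) ne
      side-gadget {i′ = i′} {j′} i₀ j₀ eq ¬P (in₁ , inj₁ refl) | no c≢x | yes _    = contradiction refl c≢x
      side-gadget {i′ = i′} {j′} i₀ j₀ eq ¬P (in₁ , inj₂ refl) | no _   | yes refl with i₀ Fin.≟ i
      ... | yes refl = contradiction (subst (T ∘ P i₀) (sym (y-index i′ j₀ eq)) Pij) ¬P
      ... | no _     = refl
      side-gadget {i′ = i′} {j′} i₀ j₀ eq ¬P (inj₁ refl , in₂) | no _   | no c≢y = contradiction refl c≢y
      side-gadget {i′ = i′} {j′} i₀ j₀ eq ¬P (inj₂ refl , in₂) | no _   | no _   = refl

      respects : ∀ a b → E S a b → ¬ (a ≡ x × b ≡ y) → ¬ (a ≡ y × b ≡ x) → U a ≡ U b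
      respects a b e n₁ n₂ with kind a in ka | kind b in kb
      ... | isSparse i₁ j₁ ea | isSparse i₂ j₂ eb = linked (subst₂ ClassAdj ea eb (φ-adj e))
        where
        -- Pattern edges lie over `xy`, so any other edge has both ends in a common gadget.
        linked : ClassAdj (sparse a i₁ j₁) (sparse b i₂ j₂) → side (isSparse i₁ j₁ ea) ≡ side (isSparse i₂ j₂ eb)
        linked (inj₁ (_ , patternEdge p q _))             = contradiction (p , q) n₁
        linked (inj₂ (_ , patternEdge p q _))             = contradiction (q , p) n₂
        linked (inj₁ (_ , gadget i₀ j₀ ¬P ina inb _ _)) =
          trans (side-gadget i₀ j₀ ea ¬P ina) (sym (side-gadget i₀ j₀ eb ¬P inb))
        linked (inj₂ (_ , gadget i₀ j₀ ¬P inb ina _ _)) =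
          trans (side-gadget i₀ j₀ ea ¬P ina) (sym (side-gadget i₀ j₀ eb ¬P inb))
      ... | isSparse i₁ j₁ ea | isLeaf w leaf with refl ← leaf a (E-sym S e) = sym (cong side ka)
      ... | isLeaf w leaf | isSparse i₂ j₂ eb with refl ← leaf b e = cong side kb
      ... | isLeaf w leaf | isLeaf w′ leaf′ with refl ← leaf b e | refl ← leaf′ a (E-sym S e) =
        trans (cong side kb) (sym (cong side ka))

      x∈U : T (U x)
      x∈U with kind x
      ... | isLeaf w leaf = ⊥-elim (x-not-leaf w leaf)
      ... | isSparse _ _ _ with x Fin.≟ x
      ...   | yes _ = tt
      ...   | no ne = ⊥-elim (ne refl)

      y∉U : ¬ T (U y)
      y∉U with kind y
      ... | isLeaf w leaf = ⊥-elim (y-not-leaf w leaf)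
      ... | isSparse _ _ _ with y Fin.≟ x | y Fin.≟ y
      ...   | yes eq | _     = contradiction (sym eq) x≢y
      ...   | no _   | yes _ = λ ()
      ...   | no _   | no ne = contradiction refl ne

      impossible : ⊥
      impossible = noCut U x∈U y∉U respects

    private
      sparse-injective : ∀ {c c′ i i′ j j′} → sparse c i j ≡ sparse c′ i′ j′ → c ≡ c′ × i ≡ i′ × j ≡ j′
      sparse-injective refl = refl , refl , refl

    -- Gadgets leave out the edge `xy`, so the section sends it to an edge of the pattern, whose
    -- indices determine the cut.
    no-section : ⊥
    no-section with kind x | kind y
    ... | isLeaf w leaf   | _               = x-not-leaf w leaf
    ... | _               | isLeaf w leaf   = y-not-leaf w leaf
    ... | isSparse i _ ex | isSparse _ j ey = Cut.impossible i j (pattern-edge (subst₂ ClassAdj ex ey (φ-adj xy)))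
        (λ i′ j′ eq → proj₁ (proj₂ (sparse-injective (trans (sym eq) ex))))
        (λ i′ j′ eq → proj₂ (proj₂ (sparse-injective (trans (sym eq) ey))))
      where
      pattern-edge : ∀ {j′ i′} → ClassAdj (sparse x i j′) (sparse y i′ j) → T (P i j)
      pattern-edge (inj₁ (_ , patternEdge _ _ p))        = p
      pattern-edge (inj₁ (_ , gadget _ _ _ _ _ n _))    = contradiction (refl , refl) n
      pattern-edge (inj₂ (_ , patternEdge y≡x _ _))      = contradiction (sym y≡x) x≢y
      pattern-edge (inj₂ (_ , gadget _ _ _ _ _ _ n))    = contradiction (refl , refl) n

  -- Let `S′` be the set of vertices with non-full image. Then `π ∘ h` maps H[S′] to H[S], and `h`
  -- makes `S′` a target, so minimality gives a map `up` back. The endomorphism `π ∘ h ∘ up` has a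
  -- right inverse `τ` on `S`, and `h ∘ up ∘ τ` is a section.
  no-homomorphism : (target : Target S) → Minimal S → NoCut S x y →
                    (h : V → Class) → ¬ (∀ {u v} → Adj H u v → ClassAdj (h u) (h v))
  no-homomorphism target minimal noCut h h-adj = hom-back target′ down λ up →
    let (τ , στ) = invertible (down ∘ᴴ up) in
    Section.no-section noCut (λ v → h (fun up (fun τ v)))
      (λ c∈ → maps up (maps τ c∈)) (λ {c} c∈ → στ c c∈)
      (λ (c∈ , c′∈ , e) → h-adj (edge up (maps τ c∈) (maps τ c′∈) (edge τ c∈ c′∈ e)))
    where
    open Core S target minimal
    S′ : VSet
    S′ v = not (isFull (h v))
    down : Hom S′ S
    down = record
      { fun  = π ∘ h
      ; maps = λ {v} _ → π∈S (h v)
      ; edge = λ {u} {v} u∈ v∈ e → proj₂ (proj₂ (π-adj (h u) (h v) u∈ v∈ (h-adj e)))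
      }
    choose : V → Class → V ⊎ Fin m
    choose v (full p) = inj₂ p
    choose v _        = inj₁ v
    choose-in : ∀ v u → h v ≡ u → InJoin S′ (choose v u)
    choose-in v (full p)       eq = tt
    choose-in v (blobA _)      eq = subst NonFull (sym eq) tt
    choose-in v (blobB _)      eq = subst NonFull (sym eq) tt
    choose-in v (sparse _ _ _) eq = subst NonFull (sym eq) tt
    choose-adj : ∀ {v v′} u u′ → Adj H v v′ → ClassAdj u u′ → JoinAdj (choose v u) (choose v′ u′)
    choose-adj (full _)       (full _)       e (inj₁ ne) = ne
    choose-adj (full _)       (full _)       e (inj₂ ne) = ne ∘ sym
    choose-adj (full _)       (blobA _)      e _ = tt
    choose-adj (full _)       (blobB _)      e _ = tt
    choose-adj (full _)       (sparse _ _ _) e _ = tt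
    choose-adj (blobA _)      (full _)       e _ = tt
    choose-adj (blobB _)      (full _)       e _ = tt
    choose-adj (sparse _ _ _) (full _)       e _ = tt
    choose-adj (blobA _)      (blobA _)      e _ = e
    choose-adj (blobA _)      (blobB _)      e _ = e
    choose-adj (blobA _)      (sparse _ _ _) e _ = e
    choose-adj (blobB _)      (blobA _)      e _ = e
    choose-adj (blobB _)      (blobB _)      e _ = e
    choose-adj (blobB _)      (sparse _ _ _) e _ = e
    choose-adj (sparse _ _ _) (blobA _)      e _ = e
    choose-adj (sparse _ _ _) (blobB _)      e _ = e
    choose-adj (sparse _ _ _) (sparse _ _ _) e _ = e
    target′ : Target S′
    target′ = record
      { to      = λ v → choose v (h v)
      ; to-in   = λ v → choose-in v (h v) refl
      ; to-edge = λ {u} {v} e → choose-adj (h u) (h v) e (h-adj e)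
      }

↔-injective : ∀ {A B : Set} (f : A ↔ B) → Inj (Inverse.to f)
↔-injective f {a} {b} eq = trans (sym (Inverse.strictlyInverseʳ f a))
  (trans (cong (Inverse.from f) eq) (Inverse.strictlyInverseʳ f b))

-- Maximal H-free supergraphs

-- With the order as a parameter, a graph and its supergraphs share their vertices definitionally.
record GraphOn (n : ℕ) : Set where
  field
    edge    : Fin n → Fin n → Bool
    symm′   : ∀ u v → edge u v ≡ edge v u
    irrefl′ : ∀ v → edge v v ≡ false

  graph : Graph
  graph = record { order = n ; adj = edge ; symm = symm′ ; irrefl = irrefl′ }

open GraphOn public using (graph)

infix 4 _⊑_

_⊑_ : ∀ {n} → GraphOn n → GraphOn n → Set
g ⊑ g′ = ∀ u v → Adj (graph g) u v → Adj (graph g′) u v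

addEdgeOn : ∀ {n} (g : GraphOn n) (u v : Fin n) → u ≢ v → GraphOn n
addEdgeOn g u v u≢v = record { edge = adj G′ ; symm′ = symm G′ ; irrefl′ = irrefl G′ }
  where
  G′ : Graph
  G′ = addEdge (graph g) u v u≢v

subgraph-⊑ : ∀ {n H} {g g′ : GraphOn n} → g ⊑ g′ → H IsSubgraphOf graph g → H IsSubgraphOf graph g′
subgraph-⊑ g⊑g′ s = record { embed = embed ; injective = injective ; preserves = λ u v e → g⊑g′ _ _ (preserves u v e) }
  where open _IsSubgraphOf_ s

addEdge-⊒ : ∀ {n} (g : GraphOn n) u v (u≢v : u ≢ v) → g ⊑ addEdgeOn g u v u≢v
addEdge-⊒ g u v u≢v a b e = Equivalence.from T-∨ (inj₁ e)

addEdge-new : ∀ {n} (g : GraphOn n) u v (u≢v : u ≢ v) → Adj (graph (addEdgeOn g u v u≢v)) u v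
addEdge-new g u v u≢v = Equivalence.from (T-∨ {GraphOn.edge g u v})
  (inj₂ (Equivalence.from T-∨ (inj₁ (T-∧⁺ (fromWitness {a? = u Fin.≟ u} refl) (fromWitness {a? = v Fin.≟ v} refl)))))

addEdge-mono : ∀ {n} {g g′ : GraphOn n} → g ⊑ g′ → ∀ u v (p q : u ≢ v) → addEdgeOn g u v p ⊑ addEdgeOn g′ u v q
addEdge-mono {g = g} {g′} g⊑g′ u v p q a b e with Equivalence.to (T-∨ {GraphOn.edge g a b}) e
... | inj₁ old = Equivalence.from T-∨ (inj₁ (g⊑g′ a b old))
... | inj₂ new = Equivalence.from (T-∨ {GraphOn.edge g′ a b}) (inj₂ new)

-- Go through all pairs and add each edge that creates no copy of `H`; by monotonicity, later edges
-- keep the earlier pairs saturated. The double negation replaces deciding whether a copy arises.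
completion : ∀ {n} H (g : GraphOn n) → H -free graph g →
             ¬ ¬ (∃ λ g′ → g ⊑ g′ × MaximalFree H (graph g′))
completion {n} H g free k = saturate (cartesianProduct (allFin n) (allFin n)) λ (g′ , g⊑g′ , free′ , sat) →
    k (g′ , g⊑g′ , free′ , λ u v u≢v ¬e → sat u v u≢v (∈-cartesianProduct⁺ (∈-allFin u) (∈-allFin v)) ¬e)
  where
  Saturated : List (Fin n × Fin n) → GraphOn n → Set
  Saturated L g′ = ∀ u v (u≢v : u ≢ v) → (u , v) ∈ˡ L → ¬ Adj (graph g′) u v → H IsSubgraphOf addEdge (graph g′) u v u≢v
  saturate : ∀ L → ¬ ¬ (∃ λ g′ → g ⊑ g′ × H -free graph g′ × Saturated L g′)
  saturate []            k = k (g , (λ _ _ e → e) , free , λ _ _ _ ())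
  saturate ((a , b) ∷ L) k = saturate L step
    where
    step : ¬ (∃ λ g′ → g ⊑ g′ × H -free graph g′ × Saturated L g′)
    step (g′ , g⊑g′ , free′ , sat) with a Fin.≟ b
    ... | yes a≡b = k (g′ , g⊑g′ , free′ , λ
          { u v u≢v (here refl) → contradiction a≡b u≢v
          ; u v u≢v (there uv∈) → sat u v u≢v uv∈ })
    ... | no  a≢b = unchanged λ creates → k (g′ , g⊑g′ , free′ , λ
          { u v u≢v (here refl) _ → subgraph-⊑ {g = addEdgeOn g′ u v a≢b} {g′ = addEdgeOn g′ u v u≢v}
                                      (addEdge-mono {g = g′} {g′} (λ _ _ e → e) u v a≢b u≢v) creates
          ; u v u≢v (there uv∈) → sat u v u≢v uv∈ })
      where
      g″ : GraphOn n
      g″ = addEdgeOn g′ a b a≢b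
      unchanged : ¬ ¬ (H IsSubgraphOf addEdge (graph g′) a b a≢b)
      unchanged free″ = k (g″ , (λ u v e → addEdge-⊒ g′ a b a≢b u v (g⊑g′ u v e)) , free″ , λ
        { u v u≢v (here refl) ¬e → contradiction (addEdge-new g′ u v a≢b) ¬e
        ; u v u≢v (there uv∈) ¬e → subgraph-⊑ {g = addEdgeOn g′ u v u≢v} {g′ = addEdgeOn g″ u v u≢v}
            (addEdge-mono {g = g′} {g″} (addEdge-⊒ g′ a b a≢b) u v u≢v u≢v)
            (sat u v u≢v uv∈ (λ e → ¬e (addEdge-⊒ g′ a b a≢b u v e))) })

shatters : ∀ G {d} (ξ : Fin d → Vertex G) (η : Fin (2 ^ d) → Vertex G) → Inj ξ →
           (∀ i j → T (decode j i) → Adj G (η j) (ξ i)) → (∀ i j → ¬ T (decode j i) → ¬ Adj G (η j) (ξ i)) →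
           d ≤ VC G
shatters G {d} ξ η ξ-inj joined apart = ≤-trans d≤∣S∣ (shattersSize⇒≤VC G (S , shattered , refl))
  where
  inS : Vertex G → Bool
  inS v = ⌊ any? (λ i → ξ i Fin.≟ v) ⌋
  S : Subset (order G)
  S = tabulate inS
  d≤∣S∣ : d ≤ ∣ S ∣
  d≤∣S∣ = subst (d ≤_) (sym (cardinality-tabulate inS))
    (injection⇒≤count inS ξ ξ-inj (λ i → fromWitness {a? = any? (λ k → ξ k Fin.≟ ξ i)} (i , refl)))
  index : ∀ {v} → v ∈ S → ∃[ i ] ξ i ≡ v
  index {v} v∈ = toWitness {a? = any? (λ i → ξ i Fin.≟ v)} (subst T (trans (sym ([]=⇒lookup v∈)) (lookup∘tabulate inS v)) tt)
  shattered : Shattered G S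
  shattered A A⊆S = η j , ⊆-antisym left right
    where
    member : Fin d → Bool
    member i = ⌊ ξ i ∈? A ⌋
    j : Fin (2 ^ d)
    j = code member
    left : nbhd G (η j) ∩ S ⊆ A
    left {v} v∈ with x∈p∩q⁻ (nbhd G (η j)) S v∈
    ... | v∈N , v∈S with index v∈S
    ... | i , refl with ξ i ∈? A
    ... | yes ∈A = ∈A
    ... | no  ∉A = contradiction (∈-nbhd G v∈N) (apart i j λ t → ∉A (toWitness (subst T (decode-code member i) t)))
    right : A ⊆ nbhd G (η j) ∩ S
    right {v} v∈A with index (A⊆S v∈A)
    ... | i , refl = x∈p∩q⁺ (∈-nbhd⁺ G (joined i j (subst T (sym (decode-code member i)) (fromWitness v∈A))) , A⊆S v∈A)

-- The blown-up graph, its degrees and its maximal supergraphs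

module Construction (H : Graph) (m : ℕ) (S : Vertex H → Bool) (x y : Vertex H)
                    (xy : Induced.E H m S x y) (C : ℕ) where

  open Induced H m

  -- All blocks have `M` vertices, the number of sparse vertices: `N + N` blocks for each full
  -- class, one for each `blobA c` and `blobB c`, one for all sparse classes. There is a y_j for
  -- each subset of `Fin d`. The `t` copies of a sparse class let one copy survive a Ramsey step for
  -- every pair. The choice `d = suc C` refutes the bound `C`.
  N d D t M weight : ℕ
  N = order H
  d = suc C
  D = 2 ^ d
  pairs : List (Fin d × Fin D)
  pairs = cartesianProduct (allFin d) (allFin D)
  t = iteratedRamseySize N (length pairs) 1
  M = N * (d * (D * t))
  weight = m * (N + N) + (N + N + 1)

  P : Fin d → Fin D → Bool
  P i j = decode j i

  open Gadgets H m S x y xy P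

  Block : Set
  Block = (Fin m × Fin (N + N)) ⊎ (Fin (N + N) ⊎ Fin 1)

  n : ℕ
  n = weight * M

  blocks : Fin weight ↔ Block
  blocks = (*↔× ⊎-↔ +↔⊎) ↔-∘ +↔⊎

  vertices : Fin n ↔ (Block × Fin M)
  vertices = (blocks ×-↔ ↔-id _) ↔-∘ *↔×

  labels : Fin M ↔ (Fin N × Fin d × Fin D × Fin t)
  labels = (↔-id _ ×-↔ ((↔-id _ ×-↔ *↔×) ↔-∘ *↔×)) ↔-∘ *↔×

  label : Fin N → Fin d → Fin D → Fin t → Fin M
  label c i j s = Inverse.from labels (c , i , j , s)

  class : Block × Fin M → Class
  class (inj₁ (p , _)        , _) = full p
  class (inj₂ (inj₁ a)       , _) = [ blobA , blobB ]′ (splitAt N a)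
  class (inj₂ (inj₂ _)       , k) = let (c , i , j , _) = Inverse.to labels k in sparse c i j

  classOf : Fin n → Class
  classOf = class ∘ Inverse.to vertices

  at : Block → Fin M → Fin n
  at b k = Inverse.from vertices (b , k)

  to-at : ∀ b k → Inverse.to vertices (at b k) ≡ (b , k)
  to-at b k = Inverse.strictlyInverseˡ vertices (b , k)

  at-injective : ∀ b k b′ k′ → at b k ≡ at b′ k′ → (b , k) ≡ (b′ , k′)
  at-injective b k b′ k′ eq = trans (sym (to-at b k)) (trans (cong (Inverse.to vertices) eq) (to-at b′ k′))

  sparseAt : Fin N → Fin d → Fin D → Fin t → Fin n
  sparseAt c i j s = at (inj₂ (inj₂ zero)) (label c i j s)

  label-injective : ∀ c i j s c′ i′ j′ s′ → label c i j s ≡ label c′ i′ j′ s′ → (c , i , j , s) ≡ (c′ , i′ , j′ , s′)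
  label-injective c i j s c′ i′ j′ s′ eq = trans (sym (Inverse.strictlyInverseˡ labels (c , i , j , s)))
    (trans (cong (Inverse.to labels) eq) (Inverse.strictlyInverseˡ labels (c′ , i′ , j′ , s′)))

  sparseAt-injective : ∀ c i j s c′ i′ j′ s′ → sparseAt c i j s ≡ sparseAt c′ i′ j′ s′ → (c , i , j , s) ≡ (c′ , i′ , j′ , s′)
  sparseAt-injective c i j s c′ i′ j′ s′ eq = label-injective c i j s c′ i′ j′ s′
    (cong proj₂ (at-injective (inj₂ (inj₂ zero)) (label c i j s) (inj₂ (inj₂ zero)) (label c′ i′ j′ s′) eq))

  class-at : ∀ b k → classOf (at b k) ≡ class (b , k)
  class-at b k = cong class (to-at b k)

  class-sparseAt : ∀ c i j s → classOf (sparseAt c i j s) ≡ sparse c i j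
  class-sparseAt c i j s = trans (class-at (inj₂ (inj₂ zero)) (label c i j s))
    (cong (λ (c , i , j , _) → sparse c i j) (Inverse.strictlyInverseˡ labels (c , i , j , s)))

  G₀ : GraphOn n
  G₀ = record
    { edge    = λ u v → ⌊ classAdj? (classOf u) (classOf v) ⌋
    ; symm′   = λ u v → swap (classOf u) (classOf v)
    ; irrefl′ = λ v → loop (classOf v)
    }
    where
    swap : ∀ a b → ⌊ classAdj? a b ⌋ ≡ ⌊ classAdj? b a ⌋
    swap a b with classAdj? a b | classAdj? b a
    ... | yes _  | yes _  = refl
    ... | no _   | no _   = refl
    ... | yes ab | no ¬ba = contradiction (Sum.swap ab) ¬ba
    ... | no ¬ab | yes ba = contradiction (Sum.swap ba) ¬ab
    loop : ∀ a → ⌊ classAdj? a a ⌋ ≡ false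
    loop a with classAdj? a a
    ... | yes (inj₁ aa) = contradiction aa (arc-irrefl a)
    ... | yes (inj₂ aa) = contradiction aa (arc-irrefl a)
    ... | no _          = refl

  G₀-adj⁺ : ∀ {u v} → ClassAdj (classOf u) (classOf v) → Adj (graph G₀) u v
  G₀-adj⁺ {u} {v} = fromWitness {a? = classAdj? (classOf u) (classOf v)}

  G₀-free : Target S → Minimal S → NoCut S x y → H -free graph G₀
  G₀-free target minimal noCut s = no-homomorphism target minimal noCut (classOf ∘ embed)
    (λ {u} {v} e → toWitness {a? = classAdj? (classOf (embed u)) (classOf (embed v))} (preserves u v e))
    where open _IsSubgraphOf_ s

  module Supergraph (g : GraphOn n) (G₀⊑g : G₀ ⊑ g) where

    G : Graph
    G = graph g

    adj⁺ : ∀ {u v} → ClassAdj (classOf u) (classOf v) → Adj G u v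
    adj⁺ {u} {v} c = G₀⊑g u v (G₀-adj⁺ {u} {v} c)

    degreeBound : ℕ
    degreeBound = (m * (N + N) + 1) * M

    -- Neighbours are counted in whole blocks: `m * (N + N) + 1` of the `weight` blocks are a
    -- proportion above m / (m + 1).
    degree≥ : ∀ v (β : (Fin m × Fin (N + N)) ⊎ Fin 1 → Block) → Inj β →
              (∀ b k → ClassAdj (classOf v) (class (β b , k))) → degreeBound ≤ degree G v
    degree≥ v β β-inj β-adj = subst (degreeBound ≤_) (sym (degree≡count G v))
      (injection⇒≤count (adj G v) e (λ {k} {k′} eq → ↔-injective places
          (e-inj (at-injective (β (block k)) (slot k) (β (block k′)) (slot k′) eq)))
        (λ k → adj⁺ {v} {e k} (subst (ClassAdj (classOf v)) (sym (class-at (β (block k)) (slot k))) (β-adj (block k) (slot k)))))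
      where
      places : Fin degreeBound ↔ (((Fin m × Fin (N + N)) ⊎ Fin 1) × Fin M)
      places = (((*↔× ⊎-↔ ↔-id _) ↔-∘ +↔⊎) ×-↔ ↔-id _) ↔-∘ *↔×
      block : Fin degreeBound → (Fin m × Fin (N + N)) ⊎ Fin 1
      block k = proj₁ (Inverse.to places k)
      slot : Fin degreeBound → Fin M
      slot k = proj₂ (Inverse.to places k)
      e : Fin degreeBound → Fin n
      e k = at (β (block k)) (slot k)
      e-inj : ∀ {b l b′ l′} → (β b , l) ≡ (β b′ , l′) → (b , l) ≡ (b′ , l′)
      e-inj eq = cong₂ _,_ (β-inj (cong proj₁ eq)) (cong proj₂ eq)

    private
      beside : Block → (Fin m × Fin (N + N)) ⊎ Fin 1 → Block
      beside b (inj₁ pa) = inj₁ pa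
      beside b (inj₂ _)  = b

      beside-inj : ∀ {b} → (∀ pa → inj₁ pa ≢ b) → Inj (beside b)
      beside-inj ne {inj₁ _}    {inj₁ _}    refl = refl
      beside-inj ne {inj₁ pa}   {inj₂ _}    eq   = contradiction eq (ne pa)
      beside-inj ne {inj₂ _}    {inj₁ pa}   eq   = contradiction (sym eq) (ne pa)
      beside-inj ne {inj₂ zero} {inj₂ zero} _    = refl

      -- A vertex of class `full p₀` misses the `N + N` blocks of its own class; the equally many
      -- blob blocks make up for them, and the sparse block is the additional one.
      across : Fin m → (Fin m × Fin (N + N)) ⊎ Fin 1 → Block
      across p₀ (inj₁ (p , a)) = if ⌊ p Fin.≟ p₀ ⌋ then inj₂ (inj₁ a) else inj₁ (p , a)
      across p₀ (inj₂ _)       = inj₂ (inj₂ zero)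

      across-inj : ∀ p₀ → Inj (across p₀)
      across-inj p₀ {inj₁ (p , a)} {inj₁ (q , b)} eq with p Fin.≟ p₀ | q Fin.≟ p₀
      across-inj p₀ {inj₁ (p , a)} {inj₁ (q , b)} refl | yes refl | yes refl = refl
      across-inj p₀ {inj₁ (p , a)} {inj₁ (q , b)} refl | no _     | no _     = refl
      across-inj p₀ {inj₁ (p , a)} {inj₂ _}       eq with p Fin.≟ p₀
      across-inj p₀ {inj₁ (p , a)} {inj₂ _}       () | yes _
      across-inj p₀ {inj₁ (p , a)} {inj₂ _}       () | no _
      across-inj p₀ {inj₂ _}       {inj₁ (p , a)} eq with p Fin.≟ p₀
      across-inj p₀ {inj₂ _}       {inj₁ (p , a)} () | yes _
      across-inj p₀ {inj₂ _}       {inj₁ (p , a)} () | no _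
      across-inj p₀ {inj₂ zero}    {inj₂ zero}    _  = refl

      full-adj : ∀ p u → NonFull u → ClassAdj (full p) u
      full-adj p (blobA _)      _ = inj₁ tt
      full-adj p (blobB _)      _ = inj₁ tt
      full-adj p (sparse _ _ _) _ = inj₁ tt

      blob-nonFull : ∀ (a : Fin N ⊎ Fin N) → NonFull ([ blobA , blobB ]′ a)
      blob-nonFull (inj₁ _) = tt
      blob-nonFull (inj₂ _) = tt

      blobBlock : Fin N ⊎ Fin N → Block
      blobBlock a = inj₂ (inj₁ (Fin.join N N a))

      class-blobBlock : ∀ a k → class (blobBlock a , k) ≡ [ blobA , blobB ]′ a
      class-blobBlock a k = cong [ blobA , blobB ]′ (Fin.splitAt-join N N a)

      nonFull-degree : ∀ v u → classOf v ≡ u → NonFull u → (a : Fin N ⊎ Fin N) → ClassAdj u ([ blobA , blobB ]′ a) →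
                       degreeBound ≤ degree G v
      nonFull-degree v u eq nf a u~a = degree≥ v (beside (blobBlock a)) (beside-inj λ _ ()) adjacent
        where
        adjacent : ∀ b k → ClassAdj (classOf v) (class (beside (blobBlock a) b , k))
        adjacent (inj₁ (p , _)) k = subst (λ z → ClassAdj z (full p)) (sym eq) (Sum.swap (full-adj p u nf))
        adjacent (inj₂ _)       k = subst₂ ClassAdj (sym eq) (sym (class-blobBlock a k)) u~a

      full-degree : ∀ v p → classOf v ≡ full p → degreeBound ≤ degree G v
      full-degree v p₀ eq = degree≥ v (across p₀) (across-inj p₀) λ b k →
          subst (λ z → ClassAdj z (class (across p₀ b , k))) (sym eq) (adjacent b k)
        where
        adjacent : ∀ b k → ClassAdj (full p₀) (class (across p₀ b , k))
        adjacent (inj₂ _)       k = inj₁ tt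
        adjacent (inj₁ (p , a)) k with p Fin.≟ p₀
        ... | yes _   = full-adj p₀ ([ blobA , blobB ]′ (splitAt N a)) (blob-nonFull (splitAt N a))
        ... | no p≢p₀ = inj₁ (p≢p₀ ∘ sym)

      degree-by-class : ∀ v u → classOf v ≡ u → degreeBound ≤ degree G v
      degree-by-class v (full p)       eq = full-degree v p eq
      degree-by-class v (blobA c)      eq = nonFull-degree v (blobA c) eq tt (inj₂ c) (inj₁ refl)
      degree-by-class v (blobB c)      eq = nonFull-degree v (blobB c) eq tt (inj₁ c) (inj₂ refl)
      degree-by-class v (sparse c i j) eq = nonFull-degree v (sparse c i j) eq tt (inj₂ c) (inj₁ refl)

    minDegree≥ : degreeBound ≤ minDegree G
    minDegree≥ = ≤minDegree G (*-monoˡ-≤ M (+-monoʳ-≤ (m * (N + N)) (m≤n+m 1 (N + N))))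
                   (λ v → degree-by-class v (classOf v) refl)

    -- Fillers for the index on which y_j, respectively x_i, does not depend.
    I₀ : Fin d
    I₀ = zero
    J₀ : Fin D
    J₀ = code {d} (λ _ → false)

    ξ : Fin t → Fin d → Fin n
    ξ s i = sparseAt x i J₀ s
    η : Fin t → Fin D → Fin n
    η s j = sparseAt y I₀ j s

    -- If the copies of x_i and y_j span a large biclique, the gadget of a non-edge (i , j)
    -- of the pattern completes it to a blowup of H[S], joined to the full classes.
    nonEdge-bicliqueFree : Target S → H -free G → ∀ i j → ¬ T (P i j) → BicliqueFree N (λ s s′ → adj G (ξ s i) (η s′ j))
    nonEdge-bicliqueFree target free i j ¬P α β α-inj β-inj fills = free record
      { embed     = λ u → place u (to target u)
      ; injective = λ {u} {v} → place-inj u v (to target u) (to target v)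
      ; preserves = λ u v e → place-adj u v (to target u) (to target v) (to-in target u) (to-in target v) (to-edge target e)
      }
      where
      coI : V → Fin d
      coI c = if ⌊ c Fin.≟ y ⌋ then I₀ else i
      coJ : V → Fin D
      coJ c = if ⌊ c Fin.≟ x ⌋ then J₀ else j
      -- The biclique prescribes the copies over `x` and `y`; over any other vertex an arbitrary
      -- injection would do.
      copy : V → V → Fin t
      copy c u = if ⌊ c Fin.≟ y ⌋ then β u else α u
      copy-inj : ∀ c {u v} → copy c u ≡ copy c v → u ≡ v
      copy-inj c eq with c Fin.≟ y
      ... | yes _ = β-inj eq
      ... | no _  = α-inj eq
      place : V → V ⊎ Fin m → Fin n
      place u (inj₁ c) = sparseAt c (coI c) (coJ c) (copy c u)
      place u (inj₂ p) = at (inj₁ (p , u ↑ˡ N)) (label u i j (α u))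
      place-inj : ∀ u v a b → place u a ≡ place v b → u ≡ v
      place-inj u v (inj₁ c) (inj₁ c′) eq = copy-inj c (trans (cong (proj₂ ∘ proj₂ ∘ proj₂) same) (cong (λ z → copy z v) (sym (cong proj₁ same))))
        where
        same : (c , coI c , coJ c , copy c u) ≡ (c′ , coI c′ , coJ c′ , copy c′ v)
        same = sparseAt-injective c (coI c) (coJ c) (copy c u) c′ (coI c′) (coJ c′) (copy c′ v) eq
      place-inj u v (inj₁ c) (inj₂ p)  eq with () ← cong proj₁ (at-injective (inj₂ (inj₂ zero)) (label c (coI c) (coJ c) (copy c u))
                                                                  (inj₁ (p , v ↑ˡ N)) (label v i j (α v)) eq)
      place-inj u v (inj₂ p) (inj₁ c)  eq with () ← cong proj₁ (at-injective (inj₁ (p , u ↑ˡ N)) (label u i j (α u))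
                                                                  (inj₂ (inj₂ zero)) (label c (coI c) (coJ c) (copy c v)) eq)
      place-inj u v (inj₂ p) (inj₂ q)  eq = cong proj₁ (label-injective u i j (α u) v i j (α v)
        (cong proj₂ (at-injective (inj₁ (p , u ↑ˡ N)) (label u i j (α u)) (inj₁ (q , v ↑ˡ N)) (label v i j (α v)) eq)))
      inGadget : ∀ c → InGadget i j c (coI c) (coJ c)
      inGadget c = first , second
        where
        first : c ≡ y ⊎ coI c ≡ i
        first with c Fin.≟ y
        ... | yes eq = inj₁ eq
        ... | no _   = inj₂ refl
        second : c ≡ x ⊎ coJ c ≡ j
        second with c Fin.≟ x
        ... | yes eq = inj₁ eq
        ... | no _   = inj₂ refl
      x≢y : x ≢ y
      x≢y = Adj-irrefl H (proj₂ (proj₂ xy))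
      place-x : ∀ u → place u (inj₁ x) ≡ ξ (α u) i
      place-x u with x Fin.≟ y | x Fin.≟ x
      ... | yes eq | _     = contradiction eq x≢y
      ... | no _   | yes _ = refl
      ... | no _   | no ne = contradiction refl ne
      place-y : ∀ u → place u (inj₁ y) ≡ η (β u) j
      place-y u with y Fin.≟ y | y Fin.≟ x
      ... | _     | yes eq = contradiction (sym eq) x≢y
      ... | yes _ | no _   = refl
      ... | no ne | no _   = contradiction refl ne
      place-xy : ∀ u v → Adj G (place u (inj₁ x)) (place v (inj₁ y))
      place-xy u v = subst₂ (Adj G) (sym (place-x u)) (sym (place-y v)) (fills u v)
      class-place : ∀ u c → classOf (place u (inj₁ c)) ≡ sparse c (coI c) (coJ c)
      class-place u c = class-sparseAt c (coI c) (coJ c) (copy c u)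
      class-full : ∀ u p → classOf (place u (inj₂ p)) ≡ full p
      class-full u p = class-at (inj₁ (p , u ↑ˡ N)) (label u i j (α u))
      place-adj : ∀ u v a b → InJoin S a → InJoin S b → JoinAdj a b → Adj G (place u a) (place v b)
      place-adj u v (inj₁ a) (inj₁ b) a∈ b∈ e with (a Fin.≟ x) ×-dec (b Fin.≟ y) | (a Fin.≟ y) ×-dec (b Fin.≟ x)
      ... | yes (refl , refl) | _                 = place-xy u v
      ... | no _              | yes (refl , refl) = Adj-sym G {place v (inj₁ x)} {place u (inj₁ y)} (place-xy v u)
      ... | no n₁             | no n₂             = adj⁺ {place u (inj₁ a)} {place v (inj₁ b)}
        (subst₂ ClassAdj (sym (class-place u a)) (sym (class-place v b))
          (inj₁ ((a∈ , b∈ , e) , gadget i j ¬P (inGadget a) (inGadget b) n₁ n₂)))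
      place-adj u v (inj₁ a) (inj₂ q) _ _ _ = adj⁺ {place u (inj₁ a)} {place v (inj₂ q)}
        (subst₂ ClassAdj (sym (class-place u a)) (sym (class-full v q)) (inj₂ tt))
      place-adj u v (inj₂ p) (inj₁ b) _ _ _ = adj⁺ {place u (inj₂ p)} {place v (inj₁ b)}
        (subst₂ ClassAdj (sym (class-full u p)) (sym (class-place v b)) (inj₁ tt))
      place-adj u v (inj₂ p) (inj₂ q) _ _ p≢q = adj⁺ {place u (inj₂ p)} {place v (inj₂ q)}
        (subst₂ ClassAdj (sym (class-full u p)) (sym (class-full v q)) (inj₁ p≢q))

    -- Ramsey's theorem leaves one copy `s` of all x_i and one copy `s′` of all y_j between which G
    -- has exactly the edges of the pattern.
    VC≥ : Target S → H -free G → d ≤ VC G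
    VC≥ target free = go (iteratedRamsey N pairs 1 R (All.tabulate λ {(i , j)} _ → R-free i j))
      where
      R : Fin d × Fin D → Fin t → Fin t → Bool
      -- On edges of the pattern the relation is empty, and then biclique-free because `N` is
      -- positive, as `x` witnesses; thus all pairs are treated alike.
      R (i , j) s s′ = not (P i j) ∧ adj G (ξ s i) (η s′ j)
      R-free : ∀ i j → BicliqueFree N (R (i , j))
      R-free i j α β α-inj β-inj fills with T? (P i j)
      ... | no ¬P = nonEdge-bicliqueFree target free i j ¬P α β α-inj β-inj (λ a b → T-∧ʳ {not (P i j)} (fills a b))
      ... | yes p = T-not (T-∧ˡ {not (P i j)} (fills x x)) p
      go : (∃₂ λ (α β : Fin 1 → Fin t) → Inj α × Inj β × All (λ ij → Avoids (R ij) α β) pairs) → d ≤ VC G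
      go (α , β , _ , _ , avoid) = shatters G (ξ s) (η s′)
          (λ {i} {i′} eq → cong (proj₁ ∘ proj₂) (sparseAt-injective x i J₀ s x i′ J₀ s eq))
          (λ i j p → Adj-sym G {ξ s i} {η s′ j} (adj⁺ {ξ s i} {η s′ j} (subst₂ ClassAdj
            (sym (class-sparseAt x i J₀ s)) (sym (class-sparseAt y I₀ j s′)) (inj₁ (xy , patternEdge refl refl p)))))
          (λ i j ¬p e → All.lookup avoid (∈-cartesianProduct⁺ (∈-allFin i) (∈-allFin j)) zero zero
            (T-∧⁺ (T-not⁺ {P i j} ¬p) (Adj-sym G {η s′ j} {ξ s i} e)))
        where
        s s′ : Fin t
        s  = α zero
        s′ = β zero

-- Comparison of the thresholds

minDegreeAtLeast-≤ : ∀ G {p q} → p ℚ.≤ q → MinDegreeAtLeast q G → MinDegreeAtLeast p G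
minDegreeAtLeast-≤ G p≤q deg = ℚ.≤-trans (ℚ.*-monoʳ-≤-nonNeg (fromℕ (order G)) {{ℚ.normalize-nonNeg (order G) 1}} p≤q) deg

-- The ratio is `degreeBound` over `n` with `M` cancelled, so it is the same for every `C`.
unbounded-VC : ∀ H m → ¬ Colourable H (suc (suc m)) →
               let N = order H in ¬ Above (δ-VC H) (ratio (m * (N + N) + 1) (m * (N + N) + (N + N)))
unbounded-VC H m ¬col (γ , (_ , C , bound) , γ<q) =
  minimal-target λ (S , target , minimal) →
  nonBridge S (¬col ∘ bicoloured⇒colourable target) λ (x , y , xy , noCut) →
  let open Construction H m S x y xy C in
  completion H G₀ (G₀-free target minimal noCut) λ (g , G₀⊑g , maximal) →
  let open Supergraph g G₀⊑g in
  1+n≰n (≤-trans (VC≥ target (proj₁ maximal)) (bound G maximal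
    (minDegreeAtLeast-≤ G (ℚ.<⇒≤ γ<q) (ratio*≤⁺ (m * (N + N) + 1) (m * (N + N) + (N + N)) n (minDegree G)
      (≤-trans (≤-reflexive (rearranged (m * (N + N)) (N + N) M)) (*-monoʳ-≤ (suc (m * (N + N) + (N + N))) minDegree≥))))))
  where
  open Induced H m
  rearranged : ∀ a b M → (a + 1) * ((a + (b + 1)) * M) ≡ suc (a + b) * ((a + 1) * M)
  rearranged = solve 3 (λ a b M → (a :+ con 1) :* ((a :+ (b :+ con 1)) :* M) := (con 1 :+ (a :+ b)) :* ((a :+ con 1) :* M)) refl
    where open +-*-Solver

δ-B<δ-VC : ∀ H₁ H₂ m → Colourable H₁ (suc (suc m)) → ¬ Colourable H₂ (suc (suc m)) → δ-B H₁ <ᴿ δ-VC H₂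
δ-B<δ-VC H₁ H₂ m col₁ ¬col₂ = ratio a d ,
    -- The mediant of m / (m + 1) and a / (d + 1), hence strictly between them.
    (ratio (m + a) (suc (m + d)) , dense⇒boundsBlowup H₁ m col₁ (≤-reflexive (sym dense)) , ratio-< (m + a) (suc (m + d)) a d below) ,
    unbounded-VC H₂ m ¬col₂
  where
  N b a d : ℕ
  N = order H₂
  b = N + N
  a = m * b + 1
  d = m * b + b
  dense : suc m * (m + a) ≡ m * suc (suc (m + d)) + 1
  dense = solve 2 (λ m b → (con 1 :+ m) :* (m :+ (m :* b :+ con 1)) :=
                           m :* (con 2 :+ (m :+ (m :* b :+ b))) :+ con 1) refl m b
    where open +-*-Solver
  below : (m + a) * suc d < a * suc (suc (m + d))
  below = ≤-reflexive (solve 2 (λ m b → con 1 :+ ((m :+ (m :* b :+ con 1)) :* (con 1 :+ (m :* b :+ b))) :=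
                           (m :* b :+ con 1) :* (con 2 :+ (m :+ (m :* b :+ b)))) refl m b)
    where open +-*-Solver

corollary1p7 : (H₁ H₂ : Graph) → 2 ≤ χ H₁ → χ H₁ < χ H₂ →
    (δ-VC H₁ ≤ᴿ δ-B H₁) × (δ-B H₁ <ᴿ δ-VC H₂) × (δ-VC H₂ ≤ᴿ δ-B H₂)
corollary1p7 H₁ H₂ 2≤χ₁ χ₁<χ₂ =
  δ-VC≤δ-B H₁ , strict 2≤χ₁ (χ-colourable H₁) (<χ⇒¬colourable H₂ χ₁<χ₂) , δ-VC≤δ-B H₂
  where
  strict : ∀ {k} → 2 ≤ k → Colourable H₁ k → ¬ Colourable H₂ k → δ-B H₁ <ᴿ δ-VC H₂
  strict {suc (suc m)} _           = δ-B<δ-VC H₁ H₂ m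
  strict {suc zero}    (s≤s ())
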